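{- Let $\mathbf{u}$ be a Sturmian sequence over $\{a,b\}$ in which the frequency of the letter $b$ equals an irrational number $\alpha\in(0,1)$. Let $\mathbf{a}=1^{\omega}$ and let $\mathbf{b}$ be a Sturmian sequence over $\{2,3\}$, and let $\gamma\in(0,1)$ be the frequency of the letter $3$ in $\mathbf{b}$. Then the sequence $\mathbf{v}=\mathrm{colour}(\mathbf{u},\mathbf{a},\mathbf{b})$ has the following properties: (i) $\mathbf{v}$ is $2$-balanced; moreover, $\mathbf{v}$ is not $1$-balanced if $\alpha\notin\{\frac{1}{1+\gamma},\frac{1}{2-\gamma}\}$; (ii) for each integer $n\ge 1$, $$\mathcal C_{\mathbf{v}}(n)\le P_\alpha(n)+(n+1)\lceil n\alpha\rceil \qquad\text{and}\qquad \mathcal C^{ab}_{\mathbf{v}}(n)\le 4.$$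
   Context: A sequence $\mathbf{w}$ over an alphabet $\mathcal A$ is $C$-balanced if for any two factors $u,v$ of $\mathbf{w}$ with $|u|=|v|$ and every letter $c$, $\bigl||u|_c-|v|_c\bigr|\le C$, where $|u|_c$ denotes the number of occurrences of $c$ in $u$. A Sturmian sequence is an aperiodic (not eventually periodic) binary $1$-balanced sequence. The frequency of a letter $c$ in $\mathbf{w}=w_0w_1\cdots$ is $\lim_{n\to\infty}|w_0\cdots w_{n-1}|_c/n$. The Parikh vector $\Psi(w)$ of a finite word $w$ is the vector of letter counts $(|w|_c)_c$. The factor complexity $\mathcal C_{\mathbf{w}}(n)$ is the number of distinct factors of length $n$ of $\mathbf{w}$; the abelian complexity $\mathcal C^{ab}_{\mathbf{w}}(n)$ is the number of distinct Parikh vectors of factors of length $n$ of $\mathbf{w}$. Colouring: given $\mathbf{u}$ over $\{a,b\}$ and sequences $\mathbf{a},\mathbf{b}$ over disjoint alphabets, $\mathrm{colour}(\mathbf{u},\mathbf{a},\mathbf{b})$ is obtained from $\mathbf{u}$ by replacing the subsequence of all $a$'s (in order) by the successive letters of $\mathbf{a}$ and the subsequence of all $b$'s by the successive letters of $\mathbf{b}$. For irrational $\alpha\in(0,1)$ and $n\ge1$, $P_\alpha(n)$ is the number of factors $u$ of length $n$ of a Sturmian sequence over $\{a,b\}$ with frequency of $b$ equal to $\alpha$ such that $\Psi(u)=(|u|_a,|u|_b)=(\lfloor(1-\alpha)n\rfloor,\lceil n\alpha\rceil)$ (this does not depend on the choice of the Sturmian sequence with that frequency, since all of them have the same set of factors).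 -}

module Defs where

open import Data.Nat as ℕ using (ℕ; zero; suc; _≤_; ∣_-_∣)
open import Data.Integer using (ℤ; +_)
open import Data.Rational as ℚ using (ℚ; _/_; 0ℚ; 1ℚ)
open import Data.Fin using (Fin; zero; suc; toℕ)
open import Data.Fin.Properties using () renaming (_≟_ to _≟F_)
open import Data.Vec using (Vec; []; _∷_; tabulate)
open import Data.List using (List; length)
open import Data.List.Membership.Propositional using (_∈_)
open import Data.List.Relation.Unary.Unique.Propositional using (Unique)
open import Data.Sum using (_⊎_; inj₁; inj₂)
open import Data.Sum.Properties using (≡-dec)
open import Data.Product using (Σ; ∃; _×_)
open import Relation.Nullary using (¬_; yes; no)
open import Relation.Binary.PropositionalEquality using (_≡_)
open import Relation.Binary.Definitions using (DecidableEquality)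

fac : {A : Set} → (ℕ → A) → ℕ → (n : ℕ) → Vec A n
fac w i n = tabulate (λ j → w (i ℕ.+ toℕ j))

count : {A : Set} → DecidableEquality A → A → {n : ℕ} → Vec A n → ℕ
count _≟_ c [] = 0
count _≟_ c (x ∷ xs) with x ≟ c
... | yes _ = suc (count _≟_ c xs)
... | no  _ = count _≟_ c xs

Balanced : {A : Set} → DecidableEquality A → ℕ → (ℕ → A) → Set
Balanced _≟_ C w = ∀ (i j n : ℕ) (c : _) →
  ∣ count _≟_ c (fac w i n) - count _≟_ c (fac w j n) ∣ ≤ C

EventuallyPeriodic : {A : Set} → (ℕ → A) → Set
EventuallyPeriodic w = Σ ℕ λ p → (1 ≤ p) × Σ ℕ λ N → ∀ i → N ≤ i → w (i ℕ.+ p) ≡ w i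

Sturmian : (ℕ → Fin 2) → Set
Sturmian w = Balanced _≟F_ 1 w × ¬ EventuallyPeriodic w

letter-a letter-b : Fin 2
letter-a = zero
letter-b = suc zero

colour : {A B : Set} → (ℕ → Fin 2) → (ℕ → A) → (ℕ → B) → ℕ → A ⊎ B
colour u a b i with u i
... | zero  = inj₁ (a (count _≟F_ letter-a (fac u 0 i)))
... | suc _ = inj₂ (b (count _≟F_ letter-b (fac u 0 i)))

-- Alphabet of v = colour(u, 1^ω, b): Fin 1 ⊎ Fin 2, where
--   inj₁ zero = letter 1,  inj₂ zero = letter 2,  inj₂ (suc zero) = letter 3.
-- The sequence b over {2,3} is encoded as ℕ → Fin 2 with zero = 2, suc zero = 3.
V : Set
V = Fin 1 ⊎ Fin 2

_≟V_ : DecidableEquality V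
_≟V_ = ≡-dec _≟F_ _≟F_

one-ω : ℕ → Fin 1
one-ω _ = zero

parikhV : {n : ℕ} → Vec V n → Vec ℕ 3
parikhV x = count _≟V_ (inj₁ zero) x ∷ count _≟V_ (inj₂ zero) x
          ∷ count _≟V_ (inj₂ (suc zero)) x ∷ []

HasCard : {A : Set} → (A → Set) → ℕ → Set
HasCard {A} S m = Σ (List A) λ L → Unique L × (length L ≡ m)
  × (∀ x → (x ∈ L → S x) × (S x → x ∈ L))

IsFactor : {A : Set} → (ℕ → A) → (n : ℕ) → Vec A n → Set
IsFactor w n f = ∃ λ i → fac w i n ≡ f

IsParikhFactorV : (ℕ → V) → ℕ → Vec ℕ 3 → Set
IsParikhFactorV v n π = ∃ λ i → parikhV (fac v i n) ≡ π

IsPFactor : (ℕ → Fin 2) → (n : ℕ) → ℕ → ℕ → Vec (Fin 2) n → Set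
IsPFactor u n ka kb f = IsFactor u n f
  × (count _≟F_ letter-a f ≡ ka) × (count _≟F_ letter-b f ≡ kb)

ratio : {A : Set} → DecidableEquality A → (ℕ → A) → A → ℕ → ℚ
ratio _≟_ w c m = + count _≟_ c (fac w 0 (suc m)) / suc m

LimEq : (ℕ → ℚ) → ℚ → Set
LimEq s x = ∀ (ε : ℚ) → 0ℚ ℚ.< ε → Σ ℕ λ N → ∀ m → N ≤ m → ℚ.∣ s m ℚ.- x ∣ ℚ.< ε

LimLt : (ℕ → ℚ) → ℚ → Set
LimLt s x = Σ ℚ λ ε → (0ℚ ℚ.< ε) × Σ ℕ λ N → ∀ m → N ≤ m → s m ℚ.+ ε ℚ.≤ x

LimGt : (ℕ → ℚ) → ℚ → Set
LimGt s x = Σ ℚ λ ε → (0ℚ ℚ.< ε) × Σ ℕ λ N → ∀ m → N ≤ m → x ℚ.+ ε ℚ.≤ s m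

ℕtoℚ : ℕ → ℚ
ℕtoℚ k = + k / 1

-- α_m → α = frequency of b in u
αseq : (ℕ → Fin 2) → ℕ → ℚ
αseq u = ratio _≟F_ u letter-b

-- γ_m → γ = frequency of 3 in b
γseq : (ℕ → Fin 2) → ℕ → ℚ
γseq b = ratio _≟F_ b (suc zero)

-- k = ⌈ n α ⌉  for irrational α:  k - 1 < nα < k
IsCeilNα : (ℕ → Fin 2) → ℕ → ℕ → Set
IsCeilNα u n k = (1 ≤ k)
  × LimGt (λ m → ℕtoℚ n ℚ.* αseq u m) (ℕtoℚ (k ℕ.∸ 1))
  × LimLt (λ m → ℕtoℚ n ℚ.* αseq u m) (ℕtoℚ k)

-- k = ⌊ (1 - α) n ⌋ for irrational α:  k < (1-α)n < k + 1
IsFloor1-αn : (ℕ → Fin 2) → ℕ → ℕ → Set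
IsFloor1-αn u n k =
    LimGt (λ m → (1ℚ ℚ.- αseq u m) ℚ.* ℕtoℚ n) (ℕtoℚ k)
  × LimLt (λ m → (1ℚ ℚ.- αseq u m) ℚ.* ℕtoℚ n) (ℕtoℚ (suc k))

-- α = 1/(1+γ)  ⇔  α(1+γ) = 1 ;   α = 1/(2-γ)  ⇔  α(2-γ) = 1
AlphaEq1/1+γ : (ℕ → Fin 2) → (ℕ → Fin 2) → Set
AlphaEq1/1+γ u b = LimEq (λ m → αseq u m ℚ.* (1ℚ ℚ.+ γseq b m)) 1ℚ

AlphaEq1/2-γ : (ℕ → Fin 2) → (ℕ → Fin 2) → Set
AlphaEq1/2-γ u b = LimEq (λ m → αseq u m ℚ.* (ℕtoℚ 2 ℚ.- γseq b m)) 1ℚ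

-- Write v = colour(u, 1^ω, b).  A window of v projects to a window of u, and its letters 2, 3
-- form a window of b whose length is the number of b's in the window of u.  Hence 2-balance,
-- and at most 2 · 2 Parikh vectors per length.  For the complexity, a balanced binary sequence
-- has at most n + 1 factors of length n (two left special factors of the same length would give
-- factors 0p0 and 1p1), and a factor of u with k letters b lifts to at most k + 1 factors of v,
-- where k is ⌈nα⌉ or ⌈nα⌉ − 1.
--
-- If v were 1-balanced, two of its three letters would alternate once the third is erased.
-- They are not 2 and 3, since b is aperiodic.  So 1 alternates with c ∈ {2, 3}, whence
-- 1 − α = α γ_c for the frequency γ_c of c in b, which is one of the two excluded equations.
module Submission where

open import Defs
open import Algebra.Properties.CommutativeSemigroup using (x∙yz≈y∙xz; xy∙z≈xz∙y)
open import Data.Empty using (⊥; ⊥-elim)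
open import Data.Fin using (Fin; zero; suc; toℕ; punchIn)
open import Data.Fin.Permutation as Perm using (Permutation′; _⟨$⟩ʳ_; _⟨$⟩ˡ_; inverseˡ; inverseʳ; transpose; _∘ₚ_)
open import Data.Fin.Properties using (_≟_; 0≢1+n; all?; injective⇒≤; punchInᵢ≢i)
open import Data.Integer as ℤ using (+_; -[1+_]; _⊖_; +<+)
import Data.Integer.Properties as ℤₚ
import Data.Integer.Tactic.RingSolver as ℤ-Solver
open import Data.List as List using (List; []; _∷_; length; _++_; filter; deduplicate)
open import Data.List.Membership.Propositional using (_∈_)
open import Data.List.Membership.Propositional.Properties
  using (∈-lookup; ∈-++⁻; ∈-filter⁻; ∈-map⁺; ∈-map⁻; ∈-deduplicate⁺; ∈-deduplicate⁻)
open import Data.List.Properties using (length-++; length-map; filter-accept; filter-reject)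
import Data.List.Relation.Unary.All as All
import Data.List.Relation.Unary.All.Properties as Allₚ
open import Data.List.Relation.Unary.AllPairs using ([]; _∷_)
open import Data.List.Relation.Unary.Any as Any using (here; there)
import Data.List.Relation.Unary.Any.Properties as Anyₚ
open import Data.List.Relation.Unary.Unique.DecPropositional.Properties using (deduplicate-!)
open import Data.List.Relation.Unary.Unique.Propositional using (Unique)
open import Data.List.Relation.Unary.Unique.Propositional.Properties using (++⁺; filter⁺)
open import Data.Nat using (ℕ; zero; suc; _≤_; _<_; _+_; _*_; _∸_; ∣_-_∣; z≤n; s≤s; _≤?_)
open import Data.Nat.ListAction using (sum)
open import Data.Nat.Properties as ℕₚ hiding (_≟_; 0≢1+n)
import Data.Nat.Tactic.RingSolver as ℕ-Solver
open import Data.Product using (_×_; _,_; proj₁; proj₂; ∃; swap)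
open import Data.Rational as ℚ using (ℚ; mkℚ; _/_; 0ℚ; 1ℚ; toℚᵘ)
import Data.Rational.Properties as ℚₚ
open import Data.Rational.Solver using (module +-*-Solver)
open import Data.Rational.Unnormalised as ℚᵘ using (mkℚᵘ; *<*; 1ℚᵘ)
import Data.Rational.Unnormalised.Properties as ℚᵘₚ
open import Data.Sum as Sum using (_⊎_; inj₁; inj₂)
open import Data.Sum.Properties using (inj₂-injective)
open import Data.Vec as Vec using (Vec; []; _∷_)
open import Data.Vec.Properties using (tabulate-cong; ∷-injective; ∷-injectiveʳ; ≡-dec)
open import Function using (_∘_; case_of_)
open import Relation.Binary.Definitions using (DecidableEquality)
open import Relation.Binary.PropositionalEquality
open import Relation.Nullary using (¬_; Dec; yes; no; contradiction)
open import Relation.Nullary.Decidable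
  using (¬¬-excluded-middle; decidable-stable; ¬?; _→-dec_; False; toWitnessFalse; from-yes)
open import Relation.Unary using (Decidable)

-- Windows and occurrence counts

-- The weight lies in a statement about balanced sequences on three recurring letters: unless the
-- sequence is eventually periodic, two of its letters alternate. Alternation says that neither
-- letter returns to itself without meeting the other, so the proof examines the returns
-- `r s ... s r` through the third letter and excludes them. If some letter, called 0, has a square,
-- then 1 and 2 are isolated between 0s, and a return 1 0...0 1 contradicts either balance or, for
-- 1001 alone, aperiodicity. If no letter has a square, then either a word 010 occurs after
-- renaming, or the period is 3.
--
-- The least count over all windows and the next position of a recurring letter exist only
-- classically. Such existence claims stay under double negation, which costs nothing, because every
-- goal that uses them is `⊥` or a decidable inequality.

window : {A : Set} → (ℕ → A) → ℕ → (n : ℕ) → Vec A n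
window w i zero    = []
window w i (suc n) = w i ∷ window w (suc i) n

fac≡window : {A : Set} (w : ℕ → A) → ∀ i n → fac w i n ≡ window w i n
fac≡window w i zero    = refl
fac≡window w i (suc n) = cong₂ _∷_ (cong w (+-identityʳ i))
  (trans (tabulate-cong (λ j → cong w (+-suc i (toℕ j)))) (fac≡window w (suc i) n))

module Occurrences {A : Set} (_≟_ : DecidableEquality A) where

  occ : (ℕ → A) → A → ℕ → ℕ → ℕ
  occ w c i n = count _≟_ c (window w i n)

  count-yes : ∀ {c x n} {f : Vec A n} → x ≡ c → count _≟_ c (x ∷ f) ≡ suc (count _≟_ c f)
  count-yes {c} {x} x≡c with x ≟ c
  ... | yes _   = refl
  ... | no  x≢c = contradiction x≡c x≢c

  count-no : ∀ {c x n} {f : Vec A n} → x ≢ c → count _≟_ c (x ∷ f) ≡ count _≟_ c f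
  count-no {c} {x} x≢c with x ≟ c
  ... | yes x≡c = contradiction x≡c x≢c
  ... | no  _   = refl

  count-step-≤ : ∀ c x {n} (f : Vec A n) → count _≟_ c f ≤ count _≟_ c (x ∷ f)
  count-step-≤ c x f with x ≟ c
  ... | yes _ = n≤1+n _
  ... | no  _ = ≤-refl

  occ-+ : ∀ w c i m n → occ w c i (m + n) ≡ occ w c i m + occ w c (i + m) n
  occ-+ w c i zero    n = cong (λ k → occ w c k n) (sym (+-identityʳ i))
  occ-+ w c i (suc m) n with w i ≟ c
  ... | yes _ = cong suc (trans (occ-+ w c (suc i) m n) (cong (λ k → occ w c (suc i) m + occ w c k n) (sym (+-suc i m))))
  ... | no  _ = trans (occ-+ w c (suc i) m n) (cong (λ k → occ w c (suc i) m + occ w c k n) (sym (+-suc i m)))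

  occ-snoc : ∀ w c i n → occ w c i (suc n) ≡ occ w c i n + occ w c (i + n) 1
  occ-snoc w c i n = trans (cong (occ w c i) (+-comm 1 n)) (occ-+ w c i n 1)

  occ-≤ : ∀ w c i n → occ w c i n ≤ n
  occ-≤ w c i zero = z≤n
  occ-≤ w c i (suc n) with w i ≟ c
  ... | yes _ = s≤s (occ-≤ w c (suc i) n)
  ... | no  _ = m≤n⇒m≤1+n (occ-≤ w c (suc i) n)

  occ-mono : ∀ w c i {m n} → m ≤ n → occ w c i m ≤ occ w c i n
  occ-mono w c i {m} m≤n = subst (λ k → occ w c i m ≤ occ w c i k) (m+[n∸m]≡n m≤n)
    (≤-trans (m≤m+n _ _) (≤-reflexive (sym (occ-+ w c i m _))))

  occ-repeat-≤ : ∀ w c {k M} → (∀ i → occ w c i k ≤ M) → ∀ t i → occ w c i (t * k) ≤ t * M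
  occ-repeat-≤ w c h zero    i = z≤n
  occ-repeat-≤ w c {k} h (suc t) i = ≤-trans (≤-reflexive (occ-+ w c i k (t * k)))
    (+-mono-≤ (h i) (occ-repeat-≤ w c h t (i + k)))

  occ-repeat-≥ : ∀ w c {k M} → (∀ i → M ≤ occ w c i k) → ∀ t i → t * M ≤ occ w c i (t * k)
  occ-repeat-≥ w c h zero    i = z≤n
  occ-repeat-≥ w c {k} h (suc t) i = ≤-trans (+-mono-≤ (h i) (occ-repeat-≥ w c h t (i + k)))
    (≤-reflexive (sym (occ-+ w c i k (t * k))))

  occ-positive : ∀ w c i n → 1 ≤ occ w c i n → ∃ λ k → w (i + k) ≡ c
  occ-positive w c i (suc n) pos with w i ≟ c
  ... | yes wi≡c = 0 , trans (cong w (+-identityʳ i)) wi≡c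
  ... | no  _    = let (k , eq) = occ-positive w c (suc i) n pos in suc k , trans (cong w (+-suc i k)) eq

  balanced⇒≤ : ∀ {C} w → Balanced _≟_ C w → ∀ c i j n → occ w c i n ≤ C + occ w c j n
  balanced⇒≤ {C} w bal c i j n = subst₂ (λ f g → count _≟_ c f ≤ C + count _≟_ c g)
    (fac≡window w i n) (fac≡window w j n)
    (≤-trans (m≤n+∣m-n∣ p q) (≤-trans (+-monoʳ-≤ q (bal i j n c)) (≤-reflexive (+-comm q C))))
    where
    p = count _≟_ c (fac w i n)
    q = count _≟_ c (fac w j n)

  ≤⇒balanced : ∀ {C w} → (∀ c i j n → occ w c i n ≤ C + occ w c j n) → Balanced _≟_ C w
  ≤⇒balanced {C} {w} h i j n c rewrite fac≡window w i n | fac≡window w j n = ∣-∣≤ (h c i j n) (h c j i n)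
    where
    ∣-∣≤ : ∀ {p q} → p ≤ C + q → q ≤ C + p → ∣ p - q ∣ ≤ C
    ∣-∣≤ {p} {q} p≤ q≤ with ≤-total p q
    ... | inj₁ p≤q = subst (_≤ C) (sym (m≤n⇒∣m-n∣≡n∸m p≤q)) (m≤n+o⇒m∸n≤o q p (≤-trans q≤ (≤-reflexive (+-comm C p))))
    ... | inj₂ q≤p = subst (_≤ C) (sym (m≤n⇒∣n-m∣≡n∸m q≤p)) (m≤n+o⇒m∸n≤o p q (≤-trans p≤ (≤-reflexive (+-comm C q))))

  -- The least count over all windows exists only classically.
  balanced-two-values : ∀ w → Balanced _≟_ 1 w → ∀ c n →
    ¬ ¬ ∃ λ k → ∀ i → occ w c i n ≡ k ⊎ occ w c i n ≡ suc k
  balanced-two-values w bal c n ¬k = ¬¬-excluded-middle {A = ∃ λ i → occ w c i n < occ w c 0 n} λ where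
      (yes (i , i<0)) → ¬k (occ w c i n , λ j →
        between (≤-pred (≤-trans i<0 (balanced⇒≤ w bal c 0 j n))) (balanced⇒≤ w bal c j i n))
      (no ¬i) → ¬k (occ w c 0 n , λ j → between (≮⇒≥ (λ j<0 → ¬i (j , j<0))) (balanced⇒≤ w bal c j 0 n))
    where
    between : ∀ {p q} → p ≤ q → q ≤ suc p → q ≡ p ⊎ q ≡ suc p
    between p≤q q≤1+p with m≤n⇒m<n∨m≡n p≤q
    ... | inj₁ p<q = inj₂ (≤-antisym q≤1+p p<q)
    ... | inj₂ p≡q = inj₁ (sym p≡q)

module _ {A A′ : Set} (_≟A_ : DecidableEquality A) (_≟A′_ : DecidableEquality A′) where
  private
    module O  = Occurrences _≟A_
    module O′ = Occurrences _≟A′_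

  occ-map : (f : A → A′) → (∀ {x y} → f x ≡ f y → x ≡ y) → ∀ w c i n → O′.occ (f ∘ w) (f c) i n ≡ O.occ w c i n
  occ-map f inj w c i zero    = refl
  occ-map f inj w c i (suc n) with w i ≟A c
  ... | yes wi≡c = trans (O′.count-yes (cong f wi≡c)) (cong suc (occ-map f inj w c (suc i) n))
  ... | no  wi≢c = trans (O′.count-no (wi≢c ∘ inj)) (occ-map f inj w c (suc i) n)

-- Lists without repetitions

lookup-injective : {A : Set} {xs : List A} → Unique xs → ∀ i j → List.lookup xs i ≡ List.lookup xs j → i ≡ j
lookup-injective (x∉ ∷ u) zero    zero    eq = refl
lookup-injective (x∉ ∷ u) zero    (suc j) eq = contradiction eq (All.lookup x∉ (∈-lookup j))
lookup-injective (x∉ ∷ u) (suc i) zero    eq = contradiction (sym eq) (All.lookup x∉ (∈-lookup i))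
lookup-injective (x∉ ∷ u) (suc i) (suc j) eq = cong suc (lookup-injective u i j eq)

unique-⊆⇒length-≤ : {A : Set} {xs ys : List A} → Unique xs → (∀ {x} → x ∈ xs → x ∈ ys) → length xs ≤ length ys
unique-⊆⇒length-≤ {xs = xs} {ys} uniq sub = injective⇒≤ {f = f} λ {i} {j} eq →
  lookup-injective uniq i j (trans (at i) (trans (cong (List.lookup ys) eq) (sym (at j))))
  where
  f : Fin (length xs) → Fin (length ys)
  f i = Any.index (sub (∈-lookup i))
  at : ∀ i → List.lookup xs i ≡ List.lookup ys (f i)
  at i = Anyₚ.lookup-index (sub (∈-lookup i))

-- Meant for the words that follow a 0 and those that follow a 1: a word in both lists is left
-- special, and there is at most one such word.
union-with-one-shared : {A : Set} → DecidableEquality A → {xs ys : List A} → Unique xs → Unique ys →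
  (∀ {x y} → x ∈ xs → x ∈ ys → y ∈ xs → y ∈ ys → x ≡ y) →
  ∃ λ zs → Unique zs × (∀ {z} → z ∈ zs → z ∈ xs ⊎ z ∈ ys) × length xs + length ys ≤ suc (length zs)
union-with-one-shared _≟_ {xs} {[]} uxs uys shared =
  xs , uxs , inj₁ , ≤-trans (≤-reflexive (+-identityʳ _)) (n≤1+n _)
union-with-one-shared _≟_ {xs} {y ∷ ys} uxs (y∉ys ∷ uys) shared with Any.any? (y ≟_) xs
-- Dropping the shared `y` makes the lists disjoint: another common element would equal `y`, which
-- does not occur again in `ys`.
... | yes y∈xs = xs ++ ys
  , ++⁺ uxs uys (λ (z∈xs , z∈ys) → All.lookup y∉ys z∈ys (shared y∈xs (here refl) z∈xs (there z∈ys)))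
  , Sum.map₂ there ∘ ∈-++⁻ xs
  , ≤-reflexive (trans (+-suc _ _) (cong suc (sym (length-++ xs))))
... | no y∉xs with union-with-one-shared _≟_ uxs uys (λ x∈xs x∈ys y∈xs y∈ys → shared x∈xs (there x∈ys) y∈xs (there y∈ys))
...   | zs , uzs , zs⊆ , len = y ∷ zs
  , All.tabulate (λ { z∈zs refl → Sum.[ y∉xs , (λ y∈ys → All.lookup y∉ys y∈ys refl) ] (zs⊆ z∈zs) }) ∷ uzs
  , (λ { (here refl) → inj₂ (here refl) ; (there z∈zs) → Sum.map₂ there (zs⊆ z∈zs) })
  , ≤-trans (≤-reflexive (+-suc _ _)) (s≤s len)

unique-map : {A B : Set} (f : A → B) {xs : List A} → (∀ {x y} → x ∈ xs → y ∈ xs → f x ≡ f y → x ≡ y) →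
  Unique xs → Unique (List.map f xs)
unique-map f inj []         = []
unique-map f inj (x∉ ∷ uxs) = Allₚ.map⁺ (All.tabulate λ y∈ fx≡fy → All.lookup x∉ y∈ (inj (here refl) (there y∈) fx≡fy))
  ∷ unique-map f (λ x∈ y∈ → inj (there x∈) (there y∈)) uxs

module _ {A : Set} {P : A → Set} (P? : Decidable P) where
  length-filter-split : ∀ xs → length xs ≡ length (filter P? xs) + length (filter (¬? ∘ P?) xs)
  length-filter-split []       = refl
  length-filter-split (x ∷ xs) with P? x
  ... | yes _ = cong suc (length-filter-split xs)
  ... | no  _ = trans (cong suc (length-filter-split xs)) (sym (+-suc _ _))

length-≤-sum-fibres : {A B : Set} → DecidableEquality B → (g : A → B) (h : B → ℕ) (S : A → Set) →
  (∀ y {xs} → Unique xs → (∀ {x} → x ∈ xs → S x × g x ≡ y) → length xs ≤ h y) →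
  ∀ ys {xs} → Unique xs → (∀ {x} → x ∈ xs → S x × g x ∈ ys) → length xs ≤ sum (List.map h ys)
length-≤-sum-fibres _≟_ g h S fibre [] {[]} u xs⊆ = z≤n
length-≤-sum-fibres _≟_ g h S fibre [] {x ∷ xs} u xs⊆ with proj₂ (xs⊆ (here refl))
... | ()
length-≤-sum-fibres _≟_ g h S fibre (y ∷ ys) {xs} u xs⊆ =
  ≤-trans (≤-reflexive (length-filter-split y? xs)) (+-mono-≤
    (fibre y (filter⁺ y? u) λ x∈ → let (x∈xs , gx≡y) = ∈-filter⁻ y? {xs = xs} x∈ in proj₁ (xs⊆ x∈xs) , gx≡y)
    (length-≤-sum-fibres _≟_ g h S fibre ys (filter⁺ (¬? ∘ y?) u) λ x∈ →
      let (x∈xs , gx≢y) = ∈-filter⁻ (¬? ∘ y?) {xs = xs} x∈ ; (Sx , gx∈) = xs⊆ x∈xs in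
      Sx , Any.tail gx≢y gx∈))
  where
  y? = λ x → g x ≟ y

-- An element with `h x ≡ k` contributes `k + 1` and any other at most `k`. With `h` the number of
-- letters b, this is how the bound splits into the term counted by `p` and the term `(n + 1) k`.
sum-suc-≤ : {A : Set} (h : A → ℕ) (k : ℕ) (xs : List A) → (∀ {x} → x ∈ xs → h x ≤ k) →
  sum (List.map (suc ∘ h) xs) ≤ length (filter (λ x → h x ℕₚ.≟ k) xs) + length xs * k
sum-suc-≤ h k []       h≤k = z≤n
sum-suc-≤ h k (x ∷ xs) h≤k = step (h x ℕₚ.≟ k)
  where
  open ≤-Reasoning
  full? = λ x → h x ℕₚ.≟ k
  l = length (filter full? xs)
  ih = sum-suc-≤ h k xs (h≤k ∘ there)
  step : Dec (h x ≡ k) → sum (List.map (suc ∘ h) (x ∷ xs)) ≤ length (filter full? (x ∷ xs)) + length (x ∷ xs) * k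
  step (yes hx≡k) = begin
    suc (h x) + sum (List.map (suc ∘ h) xs)                      ≤⟨ +-mono-≤ (s≤s (h≤k (here refl))) ih ⟩
    suc k + (l + length xs * k)                                  ≡⟨ cong suc (x∙yz≈y∙xz +-commutativeSemigroup k l (length xs * k)) ⟩
    suc l + (k + length xs * k)                                  ≡⟨ cong (λ ys → length ys + (k + length xs * k)) (sym (filter-accept full? hx≡k)) ⟩
    length (filter full? (x ∷ xs)) + (k + length xs * k)         ∎
  step (no hx≢k) = begin
    suc (h x) + sum (List.map (suc ∘ h) xs)                      ≤⟨ +-mono-≤ (≤∧≢⇒< (h≤k (here refl)) hx≢k) ih ⟩
    k + (l + length xs * k)                                      ≡⟨ x∙yz≈y∙xz +-commutativeSemigroup k l (length xs * k) ⟩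
    l + (k + length xs * k)                                      ≡⟨ cong (λ ys → length ys + (k + length xs * k)) (sym (filter-reject full? hx≢k)) ⟩
    length (filter full? (x ∷ xs)) + (k + length xs * k)         ∎

-- The colouring

pattern 1F = suc zero

module Binary = Occurrences {Fin 2} _≟_
module Letters = Occurrences {V} _≟V_

open Binary using (occ)

occ-binary : ∀ w i n → occ w zero i n + occ w 1F i n ≡ n
occ-binary w i zero = refl
occ-binary w i (suc n) with w i
... | zero = cong suc (occ-binary w (suc i) n)
... | 1F   = trans (+-suc _ _) (cong suc (occ-binary w (suc i) n))

zero-or-one : (x : Fin 2) → x ≡ zero ⊎ x ≡ 1F
zero-or-one zero = inj₁ refl
zero-or-one 1F   = inj₂ refl

module Coloured (u b : ℕ → Fin 2) where
  open ≤-Reasoning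

  v : ℕ → V
  v = colour u one-ω b

  -- The position in `b` from which a window of `v` starting at `i` takes its first coloured letter.
  B : ℕ → ℕ
  B i = occ u 1F 0 i

  B-+ : ∀ i n → B (i + n) ≡ B i + occ u 1F i n
  B-+ = Binary.occ-+ u 1F 0

  v-at-a : ∀ {i} → u i ≡ zero → v i ≡ inj₁ zero
  v-at-a {i} eq with u i
  v-at-a refl | zero = refl

  v-at-b : ∀ {i} → u i ≡ 1F → v i ≡ inj₂ (b (B i))
  v-at-b {i} eq with u i
  v-at-b {i} refl | 1F = cong (inj₂ ∘ b ∘ count _≟_ 1F) (fac≡window u 0 i)

  B-suc-a : ∀ {i} → u i ≡ zero → B (suc i) ≡ B i
  B-suc-a {i} eq = trans (Binary.occ-snoc u 1F 0 i)
    (trans (cong (λ k → B i + k) (Binary.count-no λ ui≡1 → 0≢1+n (trans (sym eq) ui≡1))) (+-identityʳ (B i)))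

  B-suc-b : ∀ {i} → u i ≡ 1F → B (suc i) ≡ suc (B i)
  B-suc-b {i} eq = trans (Binary.occ-snoc u 1F 0 i)
    (trans (cong (λ k → B i + k) (Binary.count-yes eq)) (+-comm (B i) 1))

  a⇒¬b : ∀ {i} → u i ≡ zero → u i ≢ 1F
  a⇒¬b ui≡0 ui≡1 = 0≢1+n (trans (sym ui≡0) ui≡1)

  occ-inj₁ : ∀ i n → Letters.occ v (inj₁ zero) i n ≡ occ u zero i n
  occ-inj₁ i zero = refl
  occ-inj₁ i (suc n) with zero-or-one (u i)
  ... | inj₁ ui≡0 = trans (Letters.count-yes (v-at-a ui≡0))
                      (trans (cong suc (occ-inj₁ (suc i) n)) (sym (Binary.count-yes ui≡0)))
  ... | inj₂ ui≡1 = trans (Letters.count-no λ vi≡1 → case trans (sym (v-at-b ui≡1)) vi≡1 of λ ())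
                      (trans (occ-inj₁ (suc i) n) (sym (Binary.count-no λ ui≡0 → a⇒¬b ui≡0 ui≡1)))

  occ-inj₂ : ∀ c i n → Letters.occ v (inj₂ c) i n ≡ occ b c (B i) (occ u 1F i n)
  occ-inj₂ c i zero = refl
  occ-inj₂ c i (suc n) with zero-or-one (u i)
  ... | inj₁ ui≡0 = trans (Letters.count-no λ vi≡c → case trans (sym (v-at-a ui≡0)) vi≡c of λ ())
    (trans (occ-inj₂ c (suc i) n) (cong₂ (occ b c) (B-suc-a ui≡0) (sym (Binary.count-no (a⇒¬b ui≡0)))))
  ... | inj₂ ui≡1 = trans (head (b (B i) ≟ c)) (cong (occ b c (B i)) (sym (Binary.count-yes ui≡1)))
    where
    tail = trans (occ-inj₂ c (suc i) n) (cong (λ k → occ b c k (occ u 1F (suc i) n)) (B-suc-b ui≡1))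
    head : Dec (b (B i) ≡ c) → Letters.occ v (inj₂ c) i (suc n) ≡ occ b c (B i) (suc (occ u 1F (suc i) n))
    head (yes bBi≡c) = trans (Letters.count-yes (trans (v-at-b ui≡1) (cong inj₂ bBi≡c)))
                         (trans (cong suc tail) (sym (Binary.count-yes bBi≡c)))
    head (no  bBi≢c) = trans (Letters.count-no λ vi≡c → bBi≢c (inj₂-injective (trans (sym (v-at-b ui≡1)) vi≡c)))
                         (trans tail (sym (Binary.count-no bBi≢c)))

  colour-2-balanced : Balanced _≟_ 1 u → Balanced _≟_ 1 b → Balanced _≟V_ 2 v
  colour-2-balanced balu balb = Letters.≤⇒balanced λ where
    (inj₁ zero) i j n → subst₂ (λ p q → p ≤ 2 + q) (sym (occ-inj₁ i n)) (sym (occ-inj₁ j n))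
      (m≤n⇒m≤1+n (Binary.balanced⇒≤ u balu zero i j n))
    -- The b-parts of the two windows differ in length by at most one, which costs one occurrence;
    -- the balance of `b` on equal lengths costs the other.
    (inj₂ c) i j n → subst₂ (λ p q → p ≤ 2 + q) (sym (occ-inj₂ c i n)) (sym (occ-inj₂ c j n)) (begin
      occ b c (B i) (occ u 1F i n)
        ≤⟨ Binary.occ-mono b c (B i) (Binary.balanced⇒≤ u balu 1F i j n) ⟩
      occ b c (B i) (suc (occ u 1F j n))
        ≡⟨ cong (occ b c (B i)) (+-comm 1 (occ u 1F j n)) ⟩
      occ b c (B i) (occ u 1F j n + 1)
        ≡⟨ Binary.occ-+ b c (B i) (occ u 1F j n) 1 ⟩
      occ b c (B i) (occ u 1F j n) + occ b c (B i + occ u 1F j n) 1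
        ≤⟨ +-mono-≤ (Binary.balanced⇒≤ b balb c (B i) (B j) (occ u 1F j n)) (Binary.occ-≤ b c _ 1) ⟩
      1 + occ b c (B j) (occ u 1F j n) + 1
        ≡⟨ +-comm (suc (occ b c (B j) (occ u 1F j n))) 1 ⟩
      2 + occ b c (B j) (occ u 1F j n) ∎)

  abelian-complexity-≤-4 : Balanced _≟_ 1 u → Balanced _≟_ 1 b →
    ∀ n c → HasCard (IsParikhFactorV v n) c → c ≤ 4
  -- The counts take two values only up to double negation, which suffices because `c ≤ 4` is
  -- decidable.
  abelian-complexity-≤-4 balu balb n c (L , uniq , len , spec) = decidable-stable (c ≤? 4) λ ¬c≤4 →
    Binary.balanced-two-values u balu 1F n λ (k , hk) →
    Binary.balanced-two-values b balb 1F k λ (g , hg) →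
    Binary.balanced-two-values b balb 1F (suc k) λ (h , hh) →
    ¬c≤4 (subst (_≤ 4) len (unique-⊆⇒length-≤ {ys = candidates k g h} uniq λ {π} π∈L →
      let (i , eq) = proj₁ (spec π) π∈L in
      subst (_∈ candidates k g h) eq (subst (_∈ candidates k g h) (sym (parikh-window i)) (member i (hk i) (hg (B i)) (hh (B i))))))
    where
    vector : ℕ → ℕ → Vec ℕ 3
    vector k g = n ∸ k ∷ k ∸ g ∷ g ∷ []

    candidates : ℕ → ℕ → ℕ → List (Vec ℕ 3)
    candidates k g h = vector k g ∷ vector k (suc g) ∷ vector (suc k) h ∷ vector (suc k) (suc h) ∷ []

    complement : ∀ w i m → occ w zero i m ≡ m ∸ occ w 1F i m
    complement w i m = trans (sym (m+n∸n≡m _ (occ w 1F i m))) (cong (_∸ occ w 1F i m) (occ-binary w i m))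

    parikh-window : ∀ i → parikhV (fac v i n) ≡ vector (occ u 1F i n) (occ b 1F (B i) (occ u 1F i n))
    parikh-window i rewrite fac≡window v i n = cong₂ _∷_ (trans (occ-inj₁ i n) (complement u i n))
      (cong₂ _∷_ (trans (occ-inj₂ zero i n) (complement b (B i) (occ u 1F i n))) (cong (_∷ []) (occ-inj₂ 1F i n)))

    member : ∀ i {k g h} → occ u 1F i n ≡ k ⊎ occ u 1F i n ≡ suc k →
      occ b 1F (B i) k ≡ g ⊎ occ b 1F (B i) k ≡ suc g → occ b 1F (B i) (suc k) ≡ h ⊎ occ b 1F (B i) (suc k) ≡ suc h →
      vector (occ u 1F i n) (occ b 1F (B i) (occ u 1F i n)) ∈ candidates k g h
    member i (inj₁ eq) (inj₁ eg) _ rewrite eq | eg = here refl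
    member i (inj₁ eq) (inj₂ eg) _ rewrite eq | eg = there (here refl)
    member i (inj₂ eq) _ (inj₁ eh) rewrite eq | eh = there (there (here refl))
    member i (inj₂ eq) _ (inj₂ eh) rewrite eq | eh = there (there (there (here refl)))

-- Factor complexity of balanced binary sequences

tailsAfter : ∀ {n} → Fin 2 → List (Vec (Fin 2) (suc n)) → List (Vec (Fin 2) n)
tailsAfter x []            = []
tailsAfter x ((y ∷ f) ∷ L) with y ≟ x
... | yes _ = f ∷ tailsAfter x L
... | no  _ = tailsAfter x L

∈-tailsAfter : ∀ {n} x (L : List (Vec (Fin 2) (suc n))) {f} → f ∈ tailsAfter x L → (x ∷ f) ∈ L
∈-tailsAfter x ((y ∷ g) ∷ L) f∈ with y ≟ x
∈-tailsAfter x ((y ∷ g) ∷ L) (here refl) | yes refl = here refl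
∈-tailsAfter x ((y ∷ g) ∷ L) (there f∈)  | yes refl = there (∈-tailsAfter x L f∈)
∈-tailsAfter x ((y ∷ g) ∷ L) f∈          | no  _    = there (∈-tailsAfter x L f∈)

unique-tailsAfter : ∀ {n} x {L : List (Vec (Fin 2) (suc n))} → Unique L → Unique (tailsAfter x L)
unique-tailsAfter x {[]} [] = []
unique-tailsAfter x {(y ∷ g) ∷ L} (g∉ ∷ u) with y ≟ x
... | yes refl = All.tabulate (λ f∈ eq → All.lookup g∉ (∈-tailsAfter x L f∈) (cong (x ∷_) eq)) ∷ unique-tailsAfter x u
... | no  _    = unique-tailsAfter x u

length-tailsAfter : ∀ {n} (L : List (Vec (Fin 2) (suc n))) →
  length L ≡ length (tailsAfter zero L) + length (tailsAfter 1F L)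
length-tailsAfter []               = refl
length-tailsAfter ((zero ∷ f) ∷ L) = cong suc (length-tailsAfter L)
length-tailsAfter ((1F   ∷ f) ∷ L) = trans (cong suc (length-tailsAfter L)) (sym (+-suc _ _))

module _ {w : ℕ → Fin 2} (bal : Balanced _≟_ 1 w) where
  open Binary using (count-yes; count-no; balanced⇒≤)

  occ-prefix : ∀ c {k n} i j → k ≤ n → window w i n ≡ window w j n → occ w c i k ≡ occ w c j k
  occ-prefix c i j z≤n       eq = refl
  occ-prefix c i j (s≤s k≤n) eq with ∷-injective eq
  ... | wi≡wj , eq′ with w j ≟ c
  ...   | yes wj≡c = trans (count-yes (trans wi≡wj wj≡c)) (cong suc (occ-prefix c (suc i) (suc j) k≤n eq′))
  ...   | no  wj≢c = trans (count-no (wj≢c ∘ trans (sym wi≡wj))) (occ-prefix c (suc i) (suc j) k≤n eq′)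

  -- The prefix of length `k` ends at the first position where the windows disagree. Before it they
  -- coincide, so the counts differ there by exactly one.
  first-difference : ∀ n i j → window w i n ≢ window w j n → ∃ λ k → k ≤ n ×
    (occ w 1F i k ≡ suc (occ w 1F j k) ⊎ occ w 1F j k ≡ suc (occ w 1F i k))
  first-difference zero    i j f≢g = contradiction refl f≢g
  first-difference (suc n) i j f≢g with zero-or-one (w i) | zero-or-one (w j)
  ... | inj₁ i≡0 | inj₂ j≡1 = 1 , s≤s z≤n , inj₂ (trans (count-yes j≡1) (cong suc (sym (count-no λ i≡1 → 0≢1+n (trans (sym i≡0) i≡1)))))
  ... | inj₂ i≡1 | inj₁ j≡0 = 1 , s≤s z≤n , inj₁ (trans (count-yes i≡1) (cong suc (sym (count-no λ j≡1 → 0≢1+n (trans (sym j≡0) j≡1)))))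
  ... | inj₁ i≡0 | inj₁ j≡0 with first-difference n (suc i) (suc j) (f≢g ∘ cong₂ _∷_ (trans i≡0 (sym j≡0)))
  ...   | k , k≤n , d = suc k , s≤s k≤n , subst₂ (λ p q → p ≡ suc q ⊎ q ≡ suc p) (zero-head i≡0) (zero-head j≡0) d
    where
    zero-head : ∀ {i k} → w i ≡ zero → occ w 1F (suc i) k ≡ occ w 1F i (suc k)
    zero-head i≡0 = sym (count-no λ i≡1 → 0≢1+n (trans (sym i≡0) i≡1))
  first-difference (suc n) i j f≢g | inj₂ i≡1 | inj₂ j≡1
      with first-difference n (suc i) (suc j) (f≢g ∘ cong₂ _∷_ (trans i≡1 (sym j≡1)))
  ...   | k , k≤n , d = suc k , s≤s k≤n , subst₂ (λ p q → p ≡ suc q ⊎ q ≡ suc p)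
            (sym (count-yes i≡1)) (sym (count-yes j≡1)) (Sum.map (cong suc) (cong suc) d)

  private
    Occurs : ∀ n → Vec (Fin 2) n → Set
    Occurs n f = ∃ λ i → window w i n ≡ f

  -- Otherwise 0p0 and 1p1 are both factors, where p is the longest common prefix of f and g.
  left-special-unique : ∀ {n} {f g : Vec (Fin 2) n} → Occurs (suc n) (zero ∷ f) → Occurs (suc n) (1F ∷ f) →
    Occurs (suc n) (zero ∷ g) → Occurs (suc n) (1F ∷ g) → f ≡ g
  left-special-unique {n} {f} {g} (i₀ , 0f) (i₁ , 1f) (j₀ , 0g) (j₁ , 1g)
    with ∷-injective 0f | ∷-injective 1f | ∷-injective 0g | ∷-injective 1g
  ... | i₀≡0 , refl | i₁≡1 , f₁ | j₀≡0 , refl | j₁≡1 , g₁ = decidable-stable (≡-dec _≟_ f g) λ f≢g →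
    case first-difference n (suc i₀) (suc j₀) f≢g of λ where
      (k , k≤n , inj₁ d) → clash i₁ j₀ k i₁≡1 j₀≡0 (trans (occ-prefix 1F (suc i₁) (suc i₀) k≤n f₁) d)
      (k , k≤n , inj₂ d) → clash j₁ i₀ k j₁≡1 i₀≡0 (trans (occ-prefix 1F (suc j₁) (suc j₀) k≤n g₁) d)
    where
    clash : ∀ i j k → w i ≡ 1F → w j ≡ zero → occ w 1F (suc i) k ≡ suc (occ w 1F (suc j) k) → ⊥
    clash i j k i≡1 j≡0 d = 1+n≰n (subst₂ (λ p q → p ≤ suc q) (trans (count-yes i≡1) (cong suc d))
      (count-no λ j≡1 → 0≢1+n (trans (sym j≡0) j≡1)) (balanced⇒≤ w bal 1F i j (suc k)))

  -- Deleting the first letter identifies two words only when the common tail is left special, and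
  -- there is at most one such tail. So passing from length `n` to `suc n` adds at most one factor.
  balanced-complexity-≤ : ∀ n {L : List (Vec (Fin 2) n)} → Unique L → (∀ {f} → f ∈ L → Occurs n f) → length L ≤ suc n
  balanced-complexity-≤ zero    u occurs = unique-⊆⇒length-≤ {ys = [] ∷ []} u λ { {[]} _ → here refl }
  balanced-complexity-≤ (suc n) {L} u occurs
    with union-with-one-shared (≡-dec _≟_) (unique-tailsAfter zero u) (unique-tailsAfter 1F u)
           (λ f∈₀ f∈₁ g∈₀ g∈₁ → left-special-unique
             (occurs (∈-tailsAfter zero L f∈₀)) (occurs (∈-tailsAfter 1F L f∈₁))
             (occurs (∈-tailsAfter zero L g∈₀)) (occurs (∈-tailsAfter 1F L g∈₁)))
  ... | M , uM , M⊆ , len = ≤-trans (≤-reflexive (length-tailsAfter L)) (≤-trans len (s≤s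
          (balanced-complexity-≤ n uM λ f∈M → Sum.[ occurs-tail ∘ occurs ∘ ∈-tailsAfter zero L , occurs-tail ∘ occurs ∘ ∈-tailsAfter 1F L ] (M⊆ f∈M))))
    where
    occurs-tail : ∀ {n x} {f : Vec (Fin 2) n} → Occurs (suc n) (x ∷ f) → Occurs n f
    occurs-tail (i , eq) = suc i , ∷-injectiveʳ eq

-- Limits of rational sequences

toℚᵘ-/ : ∀ i m → toℚᵘ (i / suc m) ℚᵘ.≃ mkℚᵘ i m
toℚᵘ-/ i m = ℚₚ.toℚᵘ-fromℚᵘ (mkℚᵘ i m)

ℕtoℚ-*-/-<⁻ : ∀ n a m k → ℕtoℚ n ℚ.* (+ a / suc m) ℚ.< ℕtoℚ k → n * a < k * suc m
ℕtoℚ-*-/-<⁻ n a m k lt = ℤₚ.drop‿+<+ (subst₂ ℤ._<_ lhs rhs (ℚᵘₚ.drop-*<* ltᵘ))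
  where
  ltᵘ : mkℚᵘ (+ n) 0 ℚᵘ.* mkℚᵘ (+ a) m ℚᵘ.< mkℚᵘ (+ k) 0
  ltᵘ = ℚᵘₚ.<-respˡ-≃ (ℚᵘₚ.≃-trans (ℚₚ.toℚᵘ-homo-* (ℕtoℚ n) (+ a / suc m)) (ℚᵘₚ.*-cong (toℚᵘ-/ (+ n) 0) (toℚᵘ-/ (+ a) m)))
    (ℚᵘₚ.<-respʳ-≃ (toℚᵘ-/ (+ k) 0) (ℚₚ.toℚᵘ-mono-< lt))
  lhs : (+ n ℤ.* + a) ℤ.* + 1 ≡ + (n * a)
  lhs = trans (ℤₚ.*-identityʳ _) (sym (ℤₚ.pos-* n a))
  rhs : + k ℤ.* + (1 * suc m) ≡ + (k * suc m)
  rhs = trans (sym (ℤₚ.pos-* k (1 * suc m))) (cong (λ d → + (k * d)) (*-identityˡ (suc m)))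

ℕtoℚ-+ : ∀ a b → ℕtoℚ a ℚ.+ ℕtoℚ b ≡ ℕtoℚ (a + b)
ℕtoℚ-+ a b = ℚₚ.toℚᵘ-injective (ℚᵘₚ.≃-trans (ℚₚ.toℚᵘ-homo-+ (ℕtoℚ a) (ℕtoℚ b))
  (ℚᵘₚ.≃-trans (ℚᵘₚ.+-cong (toℚᵘ-/ (+ a) 0) (toℚᵘ-/ (+ b) 0))
  (ℚᵘₚ.≃-trans (ℚᵘ.*≡* (cong (λ z → z ℤ.* + 1) (cong₂ ℤ._+_ (ℤₚ.*-identityʳ (+ a)) (ℤₚ.*-identityʳ (+ b)))))
    (ℚᵘₚ.≃-sym (toℚᵘ-/ (+ (a + b)) 0)))))

ℕtoℚ-cancel-< : ∀ {a b} → ℕtoℚ a ℚ.< ℕtoℚ b → a < b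
ℕtoℚ-cancel-< {a} {b} lt = ℤₚ.drop‿+<+ (subst₂ ℤ._<_ (ℤₚ.*-identityʳ (+ a)) (ℤₚ.*-identityʳ (+ b))
  (ℚᵘₚ.drop-*<* (ℚᵘₚ.<-respˡ-≃ (toℚᵘ-/ (+ a) 0) (ℚᵘₚ.<-respʳ-≃ (toℚᵘ-/ (+ b) 0) (ℚₚ.toℚᵘ-mono-< lt)))))

p<p+ε : ∀ p {ε} → 0ℚ ℚ.< ε → p ℚ.< p ℚ.+ ε
p<p+ε p {ε} 0<ε = subst (ℚ._< p ℚ.+ ε) (ℚₚ.+-identityʳ p) (ℚₚ.+-monoʳ-< p 0<ε)

LimGt⇒< : ∀ s x → LimGt s x → ∃ λ N → ∀ m → N ≤ m → x ℚ.< s m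
LimGt⇒< s x (ε , 0<ε , N , h) = N , λ m N≤m → ℚₚ.<-≤-trans (p<p+ε x 0<ε) (h m N≤m)

LimLt⇒< : ∀ s x → LimLt s x → ∃ λ N → ∀ m → N ≤ m → s m ℚ.< x
LimLt⇒< s x (ε , 0<ε , N , h) = N , λ m N≤m → ℚₚ.<-≤-trans (p<p+ε (s m) 0<ε) (h m N≤m)

[1-x]y+yx≡y : ∀ x y → (1ℚ ℚ.- x) ℚ.* y ℚ.+ y ℚ.* x ≡ y
[1-x]y+yx≡y = solve 2 (λ x y → (con 1ℚ :- x) :* y :+ y :* x := y) refl
  where open +-*-Solver

-- At every index the approximations of (1 - α)n and nα sum to exactly `n`. Adding their strict
-- bounds at an index beyond both thresholds gives ka + (ceil - 1) < n < (ka + 1) + ceil, where ceil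
-- is ⌈nα⌉.
floor+ceil≡n : ∀ u n {ka kb} → IsFloor1-αn u n ka → IsCeilNα u n kb → n ≡ ka + kb
floor+ceil≡n u n {ka} {suc kb} (floor< , <floor+1) (_ , ceil-1< , <ceil) =
  ≤-antisym (≤-pred upper) lower
  where
  αn nα : ℕ → ℚ
  αn m = (1ℚ ℚ.- αseq u m) ℚ.* ℕtoℚ n
  nα m = ℕtoℚ n ℚ.* αseq u m
  f< = LimGt⇒< αn (ℕtoℚ ka) floor<
  <f = LimLt⇒< αn (ℕtoℚ (suc ka)) <floor+1
  c< = LimGt⇒< nα (ℕtoℚ kb) ceil-1<
  <c = LimLt⇒< nα (ℕtoℚ (suc kb)) <ceil
  m₁ = proj₁ f< + proj₁ c<
  m₂ = proj₁ <f + proj₁ <c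
  lower : ka + suc kb ≤ n
  lower = subst (_≤ n) (sym (+-suc ka kb)) (ℕtoℚ-cancel-< (subst₂ ℚ._<_ (ℕtoℚ-+ ka kb) ([1-x]y+yx≡y (αseq u m₁) (ℕtoℚ n))
    (ℚₚ.+-mono-< {ℕtoℚ ka} {αn m₁} {ℕtoℚ kb} {nα m₁} (proj₂ f< m₁ (m≤m+n _ _)) (proj₂ c< m₁ (m≤n+m _ _)))))
  upper : n < suc ka + suc kb
  upper = ℕtoℚ-cancel-< (subst₂ ℚ._<_ ([1-x]y+yx≡y (αseq u m₂) (ℕtoℚ n)) (ℕtoℚ-+ (suc ka) (suc kb))
    (ℚₚ.+-mono-< {αn m₂} {ℕtoℚ (suc ka)} {nα m₂} {ℕtoℚ (suc kb)} (proj₂ <f m₂ (m≤m+n _ _)) (proj₂ <c m₂ (m≤n+m _ _))))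

-- A window with more than `kb` letters b would, by balance, force at least `kb` of them into every
-- window of length `n`. Then long prefixes would have density at least `kb / n`, against nα < kb.
occ-≤-ceil : ∀ u → Balanced _≟_ 1 u → ∀ n {kb} → 1 ≤ n → IsCeilNα u n kb → ∀ i → occ u 1F i n ≤ kb
occ-≤-ceil u bal n@(suc n′) {kb} 1≤n (_ , _ , <ceil) i = ≮⇒≥ λ kb<occ →
  let all≥ = λ j → ≤-pred (≤-trans kb<occ (Binary.balanced⇒≤ u bal 1F i j n))
  in <-irrefl refl (begin-strict
    kb * (suc N * n)                     ≡⟨ *-comm kb (suc N * n) ⟩
    suc N * n * kb                       ≡⟨ cong (_* kb) (*-comm (suc N) n) ⟩
    n * suc N * kb                       ≡⟨ *-assoc n (suc N) kb ⟩
    n * (suc N * kb)                     ≤⟨ *-monoʳ-≤ n (Binary.occ-repeat-≥ u 1F all≥ (suc N) 0) ⟩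
    n * occ u 1F 0 (suc N * n)    ≡⟨ cong (λ f → n * count _≟_ 1F f) (sym (fac≡window u 0 (suc N * n))) ⟩
    n * count _≟_ 1F (fac u 0 (suc N * n))
      -- `αseq u m` reads `suc m` letters, so the prefix of length `suc N * n` has index
      -- `n′ + N * n`, which is at least `N`.
      <⟨ ℕtoℚ-*-/-<⁻ n _ (n′ + N * n) kb (proj₂ <c (n′ + N * n) (≤-trans (m≤m*n N n) (m≤n+m _ n′))) ⟩
    kb * (suc N * n) ∎)
  where
  open ≤-Reasoning
  <c = LimLt⇒< (λ m → ℕtoℚ n ℚ.* αseq u m) (ℕtoℚ kb) <ceil
  N = proj₁ <c

-- Factor complexity of the colouring

uncolour : V → Fin 2
uncolour (inj₁ _) = zero
uncolour (inj₂ _) = 1F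

-- The first m letters of the b-part, padded with zero if there are fewer.
bLetters : ∀ {n} → Vec V n → (m : ℕ) → Vec (Fin 2) m
bLetters []           m       = Vec.replicate m zero
bLetters (inj₁ _ ∷ f) m       = bLetters f m
bLetters (inj₂ c ∷ f) zero    = []
bLetters (inj₂ c ∷ f) (suc m) = c ∷ bLetters f m

colouring-injective : ∀ {n} (f g : Vec V n) → Vec.map uncolour f ≡ Vec.map uncolour g → ∀ {m} →
  count _≟_ 1F (Vec.map uncolour f) ≡ m → bLetters f m ≡ bLetters g m → f ≡ g
colouring-injective []              []              _  _    _  = refl
colouring-injective (inj₁ zero ∷ f) (inj₁ zero ∷ g) eq eqm  eb =
  cong (inj₁ zero ∷_) (colouring-injective f g (∷-injectiveʳ eq) eqm eb)
colouring-injective (inj₂ c ∷ f)    (inj₂ d ∷ g)    eq refl eb with ∷-injective eb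
... | c≡d , eb′ = cong₂ (λ e → inj₂ e ∷_) c≡d (colouring-injective f g (∷-injectiveʳ eq) refl eb′)

module _ (u b : ℕ → Fin 2) where
  open Coloured u b

  uncolour-v : ∀ i → uncolour (v i) ≡ u i
  uncolour-v i with zero-or-one (u i)
  ... | inj₁ ui≡0 = trans (cong uncolour (v-at-a ui≡0)) (sym ui≡0)
  ... | inj₂ ui≡1 = trans (cong uncolour (v-at-b ui≡1)) (sym ui≡1)

  uncolour-window : ∀ i n → Vec.map uncolour (window v i n) ≡ window u i n
  uncolour-window i zero    = refl
  uncolour-window i (suc n) = cong₂ _∷_ (uncolour-v i) (uncolour-window (suc i) n)

  bLetters-window : ∀ i n m → m ≡ occ u 1F i n → bLetters (window v i n) m ≡ window b (B i) m
  bLetters-window i zero    m refl = refl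
  bLetters-window i (suc n) m eq with zero-or-one (u i)
  ... | inj₁ ui≡0 = trans (cong (λ x → bLetters (x ∷ window v (suc i) n) m) (v-at-a ui≡0))
    (trans (bLetters-window (suc i) n m (trans eq (Binary.count-no (a⇒¬b ui≡0))))
           (cong (λ k → window b k m) (B-suc-a ui≡0)))
  ... | inj₂ ui≡1 with trans eq (Binary.count-yes ui≡1)
  ...   | refl = trans (cong (λ x → bLetters (x ∷ window v (suc i) n) (suc k)) (v-at-b ui≡1))
    (cong (b (B i) ∷_) (trans (bLetters-window (suc i) n k refl) (cong (λ j → window b j k) (B-suc-b ui≡1))))
    where k = occ u 1F (suc i) n

  complexity-≤ : Balanced _≟_ 1 u → Balanced _≟_ 1 b → ∀ n → 1 ≤ n → ∀ ka kb p c →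
    IsFloor1-αn u n ka → IsCeilNα u n kb → HasCard (IsPFactor u n ka kb) p → HasCard (IsFactor v n) c →
    c ≤ p + suc n * kb
  complexity-≤ balu balb n 1≤n ka kb p c isFloor isCeil (P , uP , lenP , specP) (L , uL , lenL , specL) = begin
    c                                            ≡⟨ sym lenL ⟩
    length L                                     ≤⟨ length-≤-sum-fibres (≡-dec _≟_) (Vec.map uncolour) (suc ∘ #b) (_∈ L)
                                                      fibre U uL (λ x∈ → x∈ , ∈-deduplicate⁺ (≡-dec _≟_) (∈-map⁺ _ x∈)) ⟩
    sum (List.map (suc ∘ #b) U)                  ≤⟨ sum-suc-≤ #b kb U (λ f∈ → let (i , eq) = U-occurs f∈ in
                                                      subst (λ f → #b f ≤ kb) eq (#b≤kb i)) ⟩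
    length (filter full? U) + length U * kb      ≤⟨ +-mono-≤ full≤p (*-monoˡ-≤ kb (balanced-complexity-≤ balu n uU U-occurs)) ⟩
    p + suc n * kb                               ∎
    where
    open ≤-Reasoning
    #b : Vec (Fin 2) n → ℕ
    #b = count _≟_ 1F

    full? = λ f → #b f ℕₚ.≟ kb

    #b≤kb : ∀ i → occ u 1F i n ≤ kb
    #b≤kb = occ-≤-ceil u balu n 1≤n isCeil

    U : List (Vec (Fin 2) n)
    U = deduplicate (≡-dec _≟_) (List.map (Vec.map uncolour) L)

    uU : Unique U
    uU = deduplicate-! (≡-dec _≟_) (List.map (Vec.map uncolour) L)

    L-occurs : ∀ {x} → x ∈ L → ∃ λ i → window v i n ≡ x
    L-occurs x∈ = let (i , eq) = proj₁ (specL _) x∈ in i , trans (sym (fac≡window v i n)) eq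

    U-occurs : ∀ {f} → f ∈ U → ∃ λ i → window u i n ≡ f
    U-occurs f∈ with ∈-map⁻ (Vec.map uncolour) (∈-deduplicate⁻ (≡-dec _≟_) _ f∈)
    ... | x , x∈ , refl with L-occurs x∈
    ...   | i , refl = i , sym (uncolour-window i n)

    -- A projected word with `kb` letters b has `n − kb = ka` letters a, hence is among the words
    -- counted by `p`.
    full≤p : length (filter full? U) ≤ p
    full≤p = subst (length (filter full? U) ≤_) lenP (unique-⊆⇒length-≤ (filter⁺ full? uU) λ f∈ → full⇒∈P (∈-filter⁻ full? {xs = U} f∈))
      where
      full⇒∈P : ∀ {f} → f ∈ U × #b f ≡ kb → f ∈ P
      full⇒∈P (f∈U , #b≡kb) with U-occurs f∈U
      ... | i , refl = proj₂ (specP _) ((i , fac≡window u i n) , +-cancelʳ-≡ kb _ ka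
        (trans (cong (λ k → occ u zero i n + k) (sym #b≡kb)) (trans (occ-binary u i n) (floor+ceil≡n u n isFloor isCeil))) , #b≡kb)

    fibre : ∀ y {xs} → Unique xs → (∀ {x} → x ∈ xs → x ∈ L × Vec.map uncolour x ≡ y) → length xs ≤ suc (#b y)
    fibre y {xs} uxs xs⊆ = ≤-trans (≤-reflexive (sym (length-map part xs)))
      (balanced-complexity-≤ balb (#b y) (unique-map part (λ {x} {x′} x∈ x′∈ → colouring-injective x x′
        (trans (proj₂ (xs⊆ x∈)) (sym (proj₂ (xs⊆ x′∈)))) (cong #b (proj₂ (xs⊆ x∈)))) uxs) part-occurs)
      where
      part = λ x → bLetters x (#b y)
      part-occurs : ∀ {f} → f ∈ List.map part xs → ∃ λ i → window b i (#b y) ≡ f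
      part-occurs f∈ with ∈-map⁻ part f∈
      ... | x , x∈ , refl with xs⊆ x∈
      ...   | x∈L , refl with L-occurs x∈L
      ...     | i , refl = B i , sym (bLetters-window i n _ (cong #b (uncolour-window i n)))

-- Balanced ternary sequences

pattern 2F = suc (suc zero)

module Ternary = Occurrences {Fin 3} _≟_
open Ternary using (count-yes; count-no; count-step-≤) renaming (occ to occ₃)

-- Equivalently, an occurrence of `p` lies between any two occurrences of `q`. In both directions
-- this says that `p` and `q` alternate once the third letter is erased.
Dominates : (ℕ → Fin 3) → Fin 3 → Fin 3 → Set
Dominates w p q = ∀ i n → occ₃ w q i n ≤ suc (occ₃ w p i n)

Alternate : (ℕ → Fin 3) → Fin 3 → Fin 3 → Set
Alternate w p q = Dominates w p q × Dominates w q p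

AlternatingPair : (ℕ → Fin 3) → Set
AlternatingPair w = ∃ λ p → ∃ λ q → p ≢ q × Alternate w p q

-- The offset `N` in `recurrent` yields occurrences that have enough letters to their left to be
-- placed inside a window.
record BalancedAperiodic (w : ℕ → Fin 3) : Set where
  field
    balanced  : Balanced _≟_ 1 w
    recurrent : ∀ c N → ¬ ¬ ∃ λ i → w (N + i) ≡ c
    aperiodic : ¬ EventuallyPeriodic w

relabel-injective : (π : Permutation′ 3) → ∀ {x y} → π ⟨$⟩ʳ x ≡ π ⟨$⟩ʳ y → x ≡ y
relabel-injective π eq = trans (sym (inverseˡ π)) (trans (cong (π ⟨$⟩ˡ_) eq) (inverseˡ π))

module _ (π : Permutation′ 3) (w : ℕ → Fin 3) where
  occ-relabel : ∀ c i n → occ₃ (λ i → π ⟨$⟩ʳ w i) (π ⟨$⟩ʳ c) i n ≡ occ₃ w c i n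
  occ-relabel = occ-map _≟_ _≟_ (π ⟨$⟩ʳ_) (relabel-injective π) w

  occ-relabel′ : ∀ c i n → occ₃ (λ i → π ⟨$⟩ʳ w i) c i n ≡ occ₃ w (π ⟨$⟩ˡ c) i n
  occ-relabel′ c i n = trans (cong (λ c → occ₃ (λ i → π ⟨$⟩ʳ w i) c i n) (sym (inverseʳ π))) (occ-relabel _ i n)

  dominates-unrelabel : ∀ {p q} → Dominates (λ i → π ⟨$⟩ʳ w i) p q → Dominates w (π ⟨$⟩ˡ p) (π ⟨$⟩ˡ q)
  dominates-unrelabel dom i n = subst₂ (λ a b → a ≤ suc b) (occ-relabel′ _ i n) (occ-relabel′ _ i n) (dom i n)

  alternatingPair-unrelabel : AlternatingPair (λ i → π ⟨$⟩ʳ w i) → AlternatingPair w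
  alternatingPair-unrelabel (p , q , p≢q , pq , qp) = π ⟨$⟩ˡ p , π ⟨$⟩ˡ q
    , (λ eq → p≢q (trans (sym (inverseʳ π)) (trans (cong (π ⟨$⟩ʳ_) eq) (inverseʳ π))))
    , dominates-unrelabel pq , dominates-unrelabel qp

  balancedAperiodic-relabel : BalancedAperiodic w → BalancedAperiodic (λ i → π ⟨$⟩ʳ w i)
  balancedAperiodic-relabel ba = record
    { balanced  = Ternary.≤⇒balanced λ c i j n → subst₂ (λ a b → a ≤ suc b) (sym (occ-relabel′ c i n)) (sym (occ-relabel′ c j n))
        (Ternary.balanced⇒≤ w balanced (π ⟨$⟩ˡ c) i j n)
    ; recurrent = λ c N ¬i → recurrent (π ⟨$⟩ˡ c) N λ (i , eq) → ¬i (i , trans (cong (π ⟨$⟩ʳ_) eq) (inverseʳ π))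
    ; aperiodic = λ (p , 1≤p , N , per) → aperiodic (p , 1≤p , N , λ i N≤i → (relabel-injective π) (per i N≤i))
    }
    where open BalancedAperiodic ba

-- Lets a square be written 00 and a word xyx be written 010, so that the case analysis is carried
-- out for one naming of the letters.
move-to-front : ∀ x y → x ≢ y → ∃ λ (π : Permutation′ 3) → π ⟨$⟩ʳ x ≡ zero × π ⟨$⟩ʳ y ≡ 1F
move-to-front zero zero x≢y = contradiction refl x≢y
move-to-front zero 1F   x≢y = Perm.id , refl , refl
move-to-front zero 2F   x≢y = transpose 1F 2F , refl , refl
move-to-front 1F   zero x≢y = transpose zero 1F , refl , refl
move-to-front 1F   1F   x≢y = contradiction refl x≢y
move-to-front 1F   2F   x≢y = transpose zero 1F ∘ₚ transpose 1F 2F , refl , refl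
move-to-front 2F   zero x≢y = transpose zero 2F ∘ₚ transpose 1F 2F , refl , refl
move-to-front 2F   1F   x≢y = transpose zero 2F , refl , refl
move-to-front 2F   2F   x≢y = contradiction refl x≢y

-- The word `s ... s r` with `k` letters `s`. Placed after an `r`, it is a return to `r` that avoids
-- the third letter.
Run : (ℕ → Fin 3) → Fin 3 → Fin 3 → ℕ → ℕ → Set
Run w s r i zero    = w i ≡ r
Run w s r i (suc k) = w i ≡ s × Run w s r (suc i) k

data Cover (s r o x : Fin 3) : Set where
  is-s : x ≡ s → Cover s r o x
  is-r : x ≡ r → Cover s r o x
  is-o : x ≡ o → Cover s r o x

cover012 : ∀ x → Cover zero 1F 2F x
cover012 zero = is-s refl
cover012 1F   = is-r refl
cover012 2F   = is-o refl

module _ (w : ℕ → Fin 3) (s r o : Fin 3) (s≢r : s ≢ r) (o≢r : o ≢ r) (cover : ∀ x → Cover s r o x)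
         (no-return : ∀ p k → w p ≡ r → ¬ Run w s r (suc p) k) where
  private
    skip : ∀ {i x n} → w i ≡ x → x ≢ r → occ₃ w r i (suc n) ≡ occ₃ w r (suc i) n
    skip wi≡x x≢r = count-no λ wi≡r → x≢r (trans (sym wi≡x) wi≡r)

    grow : ∀ i n → occ₃ w o (suc i) n ≤ occ₃ w o i (suc n)
    grow i n = count-step-≤ o (w i) (window w (suc i) n)

  -- Two states of one left-to-right scan. In the first, one `r` may still come ahead of its `o`.
  -- Reading that `r` leads to the second, where no excess is left and an `o` must come before the
  -- next `r`; reading that `o` leads back to the first.
  dominates-from-no-return  : Dominates w o r
  dominates-after-no-return : ∀ i n → (∀ k → ¬ Run w s r i k) → occ₃ w r i n ≤ occ₃ w o i n

  dominates-from-no-return i zero = z≤n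
  dominates-from-no-return i (suc n) with cover (w i)
  ... | is-s wi≡s = ≤-trans (≤-reflexive (skip wi≡s s≢r)) (≤-trans (dominates-from-no-return (suc i) n) (s≤s (grow i n)))
  ... | is-o wi≡o = ≤-trans (≤-reflexive (skip wi≡o o≢r)) (≤-trans (dominates-from-no-return (suc i) n) (s≤s (grow i n)))
  ... | is-r wi≡r = ≤-trans (≤-reflexive (count-yes wi≡r))
    (s≤s (≤-trans (dominates-after-no-return (suc i) n (λ k → no-return i k wi≡r)) (grow i n)))

  dominates-after-no-return i zero    ¬run = z≤n
  dominates-after-no-return i (suc n) ¬run with cover (w i)
  ... | is-s wi≡s = ≤-trans (≤-reflexive (skip wi≡s s≢r))
    (≤-trans (dominates-after-no-return (suc i) n (λ k run → ¬run (suc k) (wi≡s , run))) (grow i n))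
  ... | is-o wi≡o = ≤-trans (≤-reflexive (skip wi≡o o≢r))
    (≤-trans (dominates-from-no-return (suc i) n) (≤-reflexive (sym (count-yes wi≡o))))
  ... | is-r wi≡r = contradiction wi≡r (¬run 0)

occ-ternary : ∀ w i n → occ₃ w zero i n + occ₃ w 1F i n + occ₃ w 2F i n ≡ n
occ-ternary w i zero = refl
occ-ternary w i (suc n) with w i
... | zero = cong suc (occ-ternary w (suc i) n)
... | 1F   = trans (cong (_+ occ₃ w 2F (suc i) n) (+-suc (occ₃ w zero (suc i) n) _)) (cong suc (occ-ternary w (suc i) n))
... | 2F   = trans (+-suc _ _) (cong suc (occ-ternary w (suc i) n))

module Clash (w : ℕ → Fin 3) (bal : Balanced _≟_ 1 w) where
  infixr 5 _∷_
  data Reads (i : ℕ) : ∀ {n} → Vec (Fin 3) n → Set where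
    []  : Reads i []
    _∷_ : ∀ {x n} {f : Vec (Fin 3) n} → w i ≡ x → Reads (suc i) f → Reads i (x ∷ f)

  reads⇒window : ∀ {i n} {f : Vec (Fin 3) n} → Reads i f → window w i n ≡ f
  reads⇒window []        = refl
  reads⇒window (eq ∷ rs) = cong₂ _∷_ eq (reads⇒window rs)

  -- Contradictions by evaluation: the first word has at least two more letters `c` than the second,
  -- and the implicit argument is filled by computing both counts.
  clash : ∀ c {i j n} {f g : Vec (Fin 3) n} → Reads i f → Reads j g →
    {False (count _≟_ c f ≤? suc (count _≟_ c g))} → ⊥
  clash c {i} {j} {n} rf rg {big} = toWitnessFalse big
    (subst₂ (λ f g → count _≟_ c f ≤ suc (count _≟_ c g)) (reads⇒window rf) (reads⇒window rg)
      (Ternary.balanced⇒≤ w bal c i j n))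

-- Balanced ternary sequences without squares of letters

module _ (w : ℕ → Fin 3) (ba : BalancedAperiodic w) (no-square : ∀ i → w i ≢ w (suc i)) where
  open BalancedAperiodic ba

  -- A return with no `s` contains `rr`, and one with two or more contains `ss`; only `rsr` is left
  -- to exclude.
  no-return-without-squares : ∀ s r → (∀ i → w i ≡ r → w (suc i) ≡ s → w (suc (suc i)) ≢ r) →
    ∀ p k → w p ≡ r → ¬ Run w s r (suc p) k
  no-return-without-squares s r ¬rsr p 0 p≡r p+1≡r = no-square p (trans p≡r (sym p+1≡r))
  no-return-without-squares s r ¬rsr p 1 p≡r (p+1≡s , p+2≡r) = ¬rsr p p≡r p+1≡s p+2≡r
  no-return-without-squares s r ¬rsr p (suc (suc k)) p≡r (p+1≡s , p+2≡s , _) = no-square (suc p) (trans p+1≡s (sym p+2≡s))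

  -- The word 010 excludes 202, which has two 2s against none, and 121, which has no 0. If 020
  -- occurs, it excludes 101, and then 1 and 2 alternate. If 020 does not occur, neither 0 nor 1
  -- returns through 2, and then 0 and 1 alternate.
  square-free-case : ∀ i → w i ≡ zero → w (suc i) ≡ 1F → w (suc (suc i)) ≡ zero → ¬ ¬ AlternatingPair w
  square-free-case i i≡0 i+1≡1 i+2≡0 ¬pair =
    ¬¬-excluded-middle {A = ∃ λ j → w j ≡ zero × w (suc j) ≡ 2F × w (suc (suc j)) ≡ zero} λ where
      (yes (j , j≡0 , j+1≡2 , j+2≡0)) → ¬pair (1F , 2F , (λ ())
        , dominates-from-no-return w zero 2F 1F (λ ()) (λ ()) (λ { zero → is-s refl ; 1F → is-o refl ; 2F → is-r refl })
            (no-return-without-squares zero 2F λ k k≡2 k+1≡0 k+2≡2 → clash 2F (k≡2 ∷ k+1≡0 ∷ k+2≡2 ∷ []) 010-window)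
        , dominates-from-no-return w zero 1F 2F (λ ()) (λ ()) cover012
            (no-return-without-squares zero 1F λ k k≡1 k+1≡0 k+2≡1 →
              clash 1F (k≡1 ∷ k+1≡0 ∷ k+2≡1 ∷ []) (j≡0 ∷ j+1≡2 ∷ j+2≡0 ∷ [])))
      (no ¬020) → ¬pair (zero , 1F , (λ ())
        , dominates-from-no-return w 2F 1F zero (λ ()) (λ ()) (λ { zero → is-o refl ; 1F → is-r refl ; 2F → is-s refl })
            (no-return-without-squares 2F 1F λ k k≡1 k+1≡2 k+2≡1 → clash zero 010-window (k≡1 ∷ k+1≡2 ∷ k+2≡1 ∷ []))
        , dominates-from-no-return w 2F zero 1F (λ ()) (λ ()) (λ { zero → is-r refl ; 1F → is-o refl ; 2F → is-s refl })
            (no-return-without-squares 2F zero λ k k≡0 k+1≡2 k+2≡0 → ¬020 (k , k≡0 , k+1≡2 , k+2≡0)))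
    where
    open Clash w balanced
    010-window : Reads i (zero ∷ 1F ∷ zero ∷ [])
    010-window = i≡0 ∷ i+1≡1 ∷ i+2≡0 ∷ []

-- Balanced ternary sequences containing the square 00

module _ (w : ℕ → Fin 3) (ba : BalancedAperiodic w) (d : ℕ) (d≡0 : w d ≡ zero) (d+1≡0 : w (suc d) ≡ zero) where
  open BalancedAperiodic ba
  open Clash w balanced

  00-square : Reads d (zero ∷ zero ∷ [])
  00-square = d≡0 ∷ d+1≡0 ∷ []

  -- Since 00 has two 0s, every window of length two has at least one.
  ≢0⇒suc≡0 : ∀ {i x} → w i ≡ suc x → w (suc i) ≡ zero
  ≢0⇒suc≡0 {i} {x} i≡x with w (suc i) in eq
  ≢0⇒suc≡0 i≡x         | zero  = refl
  ≢0⇒suc≡0 {x = zero} i≡x | 1F = ⊥-elim (clash zero 00-square (i≡x ∷ eq ∷ []))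
  ≢0⇒suc≡0 {x = zero} i≡x | 2F = ⊥-elim (clash zero 00-square (i≡x ∷ eq ∷ []))
  ≢0⇒suc≡0 {x = 1F} i≡x   | 1F = ⊥-elim (clash zero 00-square (i≡x ∷ eq ∷ []))
  ≢0⇒suc≡0 {x = 1F} i≡x   | 2F = ⊥-elim (clash zero 00-square (i≡x ∷ eq ∷ []))

  suc≢0⇒≡0 : ∀ {i x} → w (suc i) ≡ suc x → w i ≡ zero
  suc≢0⇒≡0 {i} i+1≡x with w i in eq
  ... | zero  = refl
  ... | suc y = case trans (sym (≢0⇒suc≡0 eq)) i+1≡x of λ ()

  ¬11 : ∀ {p} → w p ≡ 1F → w (1 + p) ≢ 1F
  ¬11 p≡1 p+1≡1 = case trans (sym (≢0⇒suc≡0 p≡1)) p+1≡1 of λ ()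

  ¬101 : ∀ {p} → w p ≡ 1F → w (1 + p) ≡ zero → w (2 + p) ≢ 1F
  -- A 2 at a positive position sits inside 020, which has no 1 against the two of 101.
  ¬101 p≡1 p+1≡0 p+2≡1 = recurrent 2F 1 λ (i , i+1≡2) →
    clash 1F (p≡1 ∷ p+1≡0 ∷ p+2≡1 ∷ []) (suc≢0⇒≡0 i+1≡2 ∷ i+1≡2 ∷ ≢0⇒suc≡0 i+1≡2 ∷ [])

  -- The word 1001 forces the period 2010010, Fraenkel's balanced word on three letters.
  module Fraenkel {p : ℕ} (p≡1 : w p ≡ 1F) (p+1≡0 : w (1 + p) ≡ zero) (p+2≡0 : w (2 + p) ≡ zero) (p+3≡1 : w (3 + p) ≡ 1F) where
    1001-window : Reads p (1F ∷ zero ∷ zero ∷ 1F ∷ [])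
    1001-window = p≡1 ∷ p+1≡0 ∷ p+2≡0 ∷ p+3≡1 ∷ []

    -- In the word x020, x = 0 leaves no 1 against the two of 1001, and x = 2 gives two 2s against
    -- none.
    before-2 : ∀ {j} → w (2 + j) ≡ 2F → w j ≡ 1F
    before-2 {j} j+2≡2 with w j in eq
    ... | zero = ⊥-elim (clash 1F 1001-window (eq ∷ suc≢0⇒≡0 j+2≡2 ∷ j+2≡2 ∷ ≢0⇒suc≡0 j+2≡2 ∷ []))
    ... | 1F   = refl
    ... | 2F   = ⊥-elim (clash 2F (eq ∷ suc≢0⇒≡0 j+2≡2 ∷ j+2≡2 ∷ ≢0⇒suc≡0 j+2≡2 ∷ []) 1001-window)

    after-2 : ∀ {j} → w (1 + j) ≡ 2F → w (3 + j) ≡ 1F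
    after-2 {j} j+1≡2 with w (3 + j) in eq
    ... | zero = ⊥-elim (clash 1F 1001-window (suc≢0⇒≡0 j+1≡2 ∷ j+1≡2 ∷ ≢0⇒suc≡0 j+1≡2 ∷ eq ∷ []))
    ... | 1F   = refl
    ... | 2F   = ⊥-elim (clash 2F (suc≢0⇒≡0 j+1≡2 ∷ j+1≡2 ∷ ≢0⇒suc≡0 j+1≡2 ∷ eq ∷ []) 1001-window)

    block : Vec (Fin 3) 7
    block = 2F ∷ zero ∷ 1F ∷ zero ∷ zero ∷ 1F ∷ zero ∷ []

    module _ {j : ℕ} (j+2≡2 : w (2 + j) ≡ 2F) where
      private
        e₀ : w j ≡ 1F
        e₀ = before-2 j+2≡2
        e₁ : w (1 + j) ≡ zero
        e₁ = suc≢0⇒≡0 j+2≡2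
        e₃ : w (3 + j) ≡ zero
        e₃ = ≢0⇒suc≡0 j+2≡2
        e₄ : w (4 + j) ≡ 1F
        e₄ = after-2 j+2≡2
        e₅ : w (5 + j) ≡ zero
        e₅ = ≢0⇒suc≡0 e₄
        e₆ : w (6 + j) ≡ zero
        e₆ with w (6 + j) in eq
        ... | zero = refl
        ... | 1F   = ⊥-elim (¬101 e₄ e₅ eq)
        ... | 2F   = ⊥-elim (clash 2F (j+2≡2 ∷ e₃ ∷ e₄ ∷ e₅ ∷ eq ∷ [])
          (p≡1 ∷ p+1≡0 ∷ p+2≡0 ∷ p+3≡1 ∷ ≢0⇒suc≡0 p+3≡1 ∷ []))
        e₇ : w (7 + j) ≡ 1F
        e₇ with w (7 + j) in eq
        ... | zero = ⊥-elim (clash zero (e₅ ∷ e₆ ∷ eq ∷ []) (e₀ ∷ e₁ ∷ j+2≡2 ∷ []))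
        ... | 1F   = refl
        ... | 2F   = case trans (sym (before-2 eq)) e₅ of λ ()
        e₈ : w (8 + j) ≡ zero
        e₈ = ≢0⇒suc≡0 e₇

      -- Each letter is forced in turn around the known 10201. The alternatives produce 101, 20102
      -- against 10010, 000 against 102, or a 2 that lacks the 1 two places before it.
      block-at-2 : window w (2 + j) 7 ≡ block
      block-at-2 = reads⇒window (j+2≡2 ∷ e₃ ∷ e₄ ∷ e₅ ∷ e₆ ∷ e₇ ∷ e₈ ∷ [])

      next-2 : w (9 + j) ≡ 2F
      next-2 with w (9 + j) in eq
      ... | zero = ⊥-elim (clash zero (e₅ ∷ e₆ ∷ e₇ ∷ e₈ ∷ eq ∷ []) (e₀ ∷ e₁ ∷ j+2≡2 ∷ e₃ ∷ e₄ ∷ []))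
      ... | 1F   = ⊥-elim (¬101 e₇ e₈ eq)
      ... | 2F   = refl

    same-block : ∀ {j} → w (2 + j) ≡ 2F → ∀ k → Vec.lookup (window w (9 + j) 7) k ≡ Vec.lookup (window w (2 + j) 7) k
    same-block e k = cong (λ f → Vec.lookup f k) (trans (block-at-2 (next-2 e)) (sym (block-at-2 e)))

    -- Offsets below seven lie inside a block, which reappears at the next 2; larger offsets are
    -- reduced by seven by starting from that next 2.
    period-7 : ∀ k {j} → w (2 + j) ≡ 2F → w (7 + (k + (2 + j))) ≡ w (k + (2 + j))
    period-7 0 e = same-block e zero
    period-7 1 e = same-block e 1F
    period-7 2 e = same-block e 2F
    period-7 3 e = same-block e (suc 2F)
    period-7 4 e = same-block e (suc (suc 2F))
    period-7 5 e = same-block e (suc (suc (suc 2F)))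
    period-7 6 e = same-block e (suc (suc (suc (suc 2F))))
    period-7 (suc (suc (suc (suc (suc (suc (suc k))))))) {j} e =
      subst (λ i → w (7 + i) ≡ w i) (x∙yz≈y∙xz +-commutativeSemigroup k 7 (2 + j)) (period-7 k (next-2 e))

    absurd : ⊥
    absurd = recurrent 2F 2 λ (j , e) → aperiodic (7 , s≤s z≤n , 2 + j , λ i 2+j≤i →
      subst₂ (λ i′ i → w i′ ≡ w i) (trans (cong (λ k → 7 + k) (m∸n+n≡m 2+j≤i)) (+-comm 7 i)) (m∸n+n≡m 2+j≤i)
        (period-7 (i ∸ (2 + j)) e))

  run-zeros : ∀ k {i} → Run w zero 1F i k → occ₃ w zero i k ≡ k
  run-zeros zero    _              = refl
  run-zeros (suc k) (i≡0 , run) = trans (count-yes i≡0) (cong suc (run-zeros k run))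

  run-ones : ∀ k {i} → Run w zero 1F i k → occ₃ w 1F i (suc k) ≡ 1
  run-ones zero    i≡1         = count-yes i≡1
  run-ones (suc k) (i≡0 , run) = trans (count-no λ i≡1 → case trans (sym i≡0) i≡1 of λ ()) (run-ones k run)

  -- Every window of length m + 3 has at most one nonzero letter, so no 1 is within distance
  -- m + 2 of a 2. This leaves a window of length m + 5 without 1, whereas 1 0ᵐ⁺³ 1 has two.
  ¬long-return : ∀ m {p} → w p ≡ 1F → ¬ Run w zero 1F (suc p) (3 + m)
  ¬long-return m {p} p≡1 run = recurrent 2F (2 + m) λ (s , e) →
    let j = 2 + m + s
        two-at-end : 1 ≤ occ₃ w 2F s (3 + m)
        two-at-end = ≤-trans (≤-reflexive (sym (count-yes {n = 0} e)))
          (≤-trans (m≤n+m (occ₃ w 2F j 1) (occ₃ w 2F s (2 + m)))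
            (≤-reflexive (trans (cong (λ i → occ₃ w 2F s (2 + m) + occ₃ w 2F i 1) (+-comm (2 + m) s))
              (trans (sym (Ternary.occ-+ w 2F s (2 + m) 1)) (cong (occ₃ w 2F s) (+-comm (2 + m) 1))))))
        two-at-start : 1 ≤ occ₃ w 2F j (3 + m)
        two-at-start = ≤-trans (s≤s z≤n) (≤-reflexive (sym (count-yes e)))
        total : occ₃ w 1F s (2 + m) + occ₃ w 1F j 3 ≡ occ₃ w 1F s (2 + (3 + m))
        total = trans (cong (λ i → occ₃ w 1F s (2 + m) + occ₃ w 1F i 3) (+-comm (2 + m) s))
          (trans (sym (Ternary.occ-+ w 1F s (2 + m) 3)) (cong (occ₃ w 1F s) (cong (λ k → 2 + k) (+-comm m 3))))
    in 1+n≰n (begin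
      1                                          ≤⟨ one-in-window s ⟩
      occ₃ w 1F s (2 + (3 + m))                   ≡⟨ sym total ⟩
      occ₃ w 1F s (2 + m) + occ₃ w 1F j 3          ≤⟨ +-mono-≤ (Ternary.occ-mono w 1F s (n≤1+n (2 + m))) (Ternary.occ-mono w 1F j (m≤m+n 3 m)) ⟩
      occ₃ w 1F s (3 + m) + occ₃ w 1F j (3 + m)    ≤⟨ +-mono-≤ (no-one s two-at-end) (no-one j two-at-start) ⟩
      0 ∎)
    where
    open ≤-Reasoning
    many-zeros : ∀ i → 2 + m ≤ occ₃ w zero i (3 + m)
    many-zeros i = ≤-pred (≤-trans (≤-reflexive (sym (run-zeros (3 + m) run))) (Ternary.balanced⇒≤ w balanced zero (suc p) i (3 + m)))
    no-one : ∀ i → 1 ≤ occ₃ w 2F i (3 + m) → occ₃ w 1F i (3 + m) ≤ 0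
    no-one i two = +-cancelˡ-≤ (3 + m) _ 0 (begin
      (3 + m) + ones           ≡⟨ cong (_+ ones) (+-comm 1 (2 + m)) ⟩
      (2 + m) + 1 + ones       ≤⟨ +-monoˡ-≤ ones (+-mono-≤ (many-zeros i) two) ⟩
      zeros + twos + ones      ≡⟨ xy∙z≈xz∙y +-commutativeSemigroup zeros twos ones ⟩
      zeros + ones + twos      ≡⟨ occ-ternary w i (3 + m) ⟩
      3 + m                    ≡⟨ sym (+-identityʳ (3 + m)) ⟩
      3 + m + 0 ∎)
      where
      zeros = occ₃ w zero i (3 + m)
      ones  = occ₃ w 1F i (3 + m)
      twos  = occ₃ w 2F i (3 + m)
    one-in-window : ∀ i → 1 ≤ occ₃ w 1F i (2 + (3 + m))
    one-in-window i = ≤-pred (≤-trans (≤-reflexive (sym (trans (count-yes p≡1) (cong suc (run-ones (3 + m) run)))))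
      (Ternary.balanced⇒≤ w balanced 1F p i (2 + (3 + m))))

  no-return-after-square : ∀ p k → w p ≡ 1F → ¬ Run w zero 1F (suc p) k
  no-return-after-square p 0 p≡1 p+1≡1                         = ¬11 p≡1 p+1≡1
  no-return-after-square p 1 p≡1 (p+1≡0 , p+2≡1)               = ¬101 p≡1 p+1≡0 p+2≡1
  no-return-after-square p 2 p≡1 (p+1≡0 , p+2≡0 , p+3≡1)       = Fraenkel.absurd p≡1 p+1≡0 p+2≡0 p+3≡1
  no-return-after-square p (suc (suc (suc m))) p≡1 run         = ¬long-return m p≡1 run

  dominates-after-square : Dominates w 2F 1F
  dominates-after-square = dominates-from-no-return w zero 1F 2F (λ ()) (λ ()) cover012 no-return-after-square

-- Existence of an alternating pair

fourth-letter : ∀ (x y z t : Fin 3) → x ≢ y → x ≢ z → y ≢ z → y ≢ t → z ≢ t → t ≡ x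
fourth-letter = from-yes (all? {n = 3} λ x → all? λ y → all? λ z → all? λ t →
  ¬? (x ≟ y) →-dec ¬? (x ≟ z) →-dec ¬? (y ≟ z) →-dec ¬? (y ≟ t) →-dec ¬? (z ≟ t) →-dec (t ≟ x))

alternating-pair : ∀ w → BalancedAperiodic w → ¬ ¬ AlternatingPair w
alternating-pair w ba ¬pair = ¬¬-excluded-middle {A = ∃ λ i → w i ≡ w (suc i)} λ where
    (yes (i , i≡i+1)) → with-square i i≡i+1
    (no ¬square) → without-squares λ i i≡i+1 → ¬square (i , i≡i+1)
  where
  open BalancedAperiodic ba

  with-square : ∀ i → w i ≢ w (suc i)
  -- Only the square letter has to be sent to 0; `punchIn` merely supplies some letter different
  -- from it.
  with-square i i≡i+1 with move-to-front (w i) (punchIn (w i) zero) (λ eq → punchInᵢ≢i (w i) zero (sym eq))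
  ... | π , πi≡0 , _ = ¬pair (alternatingPair-unrelabel π w (2F , 1F , (λ ())
      , dominates-after-square w′ ba′ i πi≡0 πi+1≡0
      -- The situation is symmetric in 1 and 2, so exchanging them gives the opposite domination.
      , dominates-unrelabel (transpose 1F 2F) w′
          (dominates-after-square (λ i → transpose 1F 2F ⟨$⟩ʳ w′ i) (balancedAperiodic-relabel (transpose 1F 2F) w′ ba′)
            i (cong (transpose 1F 2F ⟨$⟩ʳ_) πi≡0) (cong (transpose 1F 2F ⟨$⟩ʳ_) πi+1≡0))))
    where
    w′ = λ i → π ⟨$⟩ʳ w i
    ba′ = balancedAperiodic-relabel π w ba
    πi+1≡0 = trans (cong (π ⟨$⟩ʳ_) (sym i≡i+1)) πi≡0

  without-squares : ¬ (∀ i → w i ≢ w (suc i))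
  -- With neither xx nor xyx, any three consecutive letters are distinct, so the fourth repeats the
  -- first and the period is 3.
  without-squares no-square = aperiodic (3 , s≤s z≤n , 0 , λ i _ → trans (cong w (+-comm i 3))
      (fourth-letter (w i) (w (1 + i)) (w (2 + i)) (w (3 + i))
        (no-square i) (¬xyx i) (no-square (1 + i)) (¬xyx (1 + i)) (no-square (2 + i))))
    where
    ¬xyx : ∀ i → w i ≢ w (2 + i)
    ¬xyx i i≡i+2 with move-to-front (w i) (w (suc i)) (no-square i)
    ... | π , πi≡0 , πi+1≡1 = square-free-case w′ (balancedAperiodic-relabel π w ba)
        (λ k eq → no-square k (relabel-injective π eq))
        i πi≡0 πi+1≡1 (trans (cong (π ⟨$⟩ʳ_) (sym i≡i+2)) πi≡0) (¬pair ∘ alternatingPair-unrelabel π w)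
      where
      w′ = λ i → π ⟨$⟩ʳ w i

-- Letter frequencies

-- Both sides approximate the count of c in a prefix of length L * k.
balanced-drift : ∀ w → Balanced _≟_ 1 w → ∀ c k L → L * occ w c 0 k ≤ k * occ w c 0 L + (k + L)
balanced-drift w bal c k L = begin
  L * occ w c 0 k                       ≤⟨ *-monoʳ-≤ L (m≤n+m∸n (occ w c 0 k) 1) ⟩
  L * suc (occ w c 0 k ∸ 1)             ≡⟨ *-suc L (occ w c 0 k ∸ 1) ⟩
  L + L * (occ w c 0 k ∸ 1)             ≤⟨ +-monoʳ-≤ L (Binary.occ-repeat-≥ w c (λ i → m≤n+o⇒m∸n≤o _ 1 (Binary.balanced⇒≤ w bal c 0 i k)) L 0) ⟩
  L + occ w c 0 (L * k)                 ≡⟨ cong (λ l → L + occ w c 0 l) (*-comm L k) ⟩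
  L + occ w c 0 (k * L)                 ≤⟨ +-monoʳ-≤ L (Binary.occ-repeat-≤ w c (λ i → Binary.balanced⇒≤ w bal c i 0 L) k 0) ⟩
  L + k * suc (occ w c 0 L)             ≡⟨ rearrange L k (occ w c 0 L) ⟩
  k * occ w c 0 L + (k + L)             ∎
  where
  open ≤-Reasoning
  rearrange : ∀ L k x → L + k * suc x ≡ k * x + (k + L)
  rearrange = ℕ-Solver.solve-∀

∣⊖∣-≤-bound : ∀ {p q K} → p ≤ q + K → q ≤ p + K → ℤ.∣ p ⊖ q ∣ ≤ K
∣⊖∣-≤-bound {p} {q} {K} p≤ q≤ with ≤-total p q
... | inj₁ p≤q = ≤-trans (≤-reflexive (ℤₚ.∣⊖∣-≤ p≤q)) (m≤n+o⇒m∸n≤o q p q≤)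
... | inj₂ q≤p = ≤-trans (≤-reflexive (trans (ℤₚ.∣m⊖n∣≡∣n⊖m∣ p q) (ℤₚ.∣⊖∣-≤ q≤p))) (m≤n+o⇒m∸n≤o p q p≤)

private
  -- Unnormalised, so that no gcd is divided out and the numerator is an explicit polynomial.
  a[1+h]-1 : ℕ → ℕ → ℕ → ℚᵘ.ℚᵘ
  a[1+h]-1 a h m = mkℚᵘ (+ a) m ℚᵘ.* (1ℚᵘ ℚᵘ.+ mkℚᵘ (+ h) m) ℚᵘ.- 1ℚᵘ

  toℚᵘ-a[1+h]-1 : ∀ a h m → toℚᵘ ((+ a / suc m) ℚ.* (1ℚ ℚ.+ (+ h / suc m)) ℚ.- 1ℚ) ℚᵘ.≃ a[1+h]-1 a h m
  toℚᵘ-a[1+h]-1 a h m = ℚᵘₚ.≃-trans (ℚₚ.toℚᵘ-homo-+ ((+ a / suc m) ℚ.* (1ℚ ℚ.+ (+ h / suc m))) (ℚ.- 1ℚ))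
    (ℚᵘₚ.+-congˡ (toℚᵘ (ℚ.- 1ℚ)) (ℚᵘₚ.≃-trans (ℚₚ.toℚᵘ-homo-* (+ a / suc m) (1ℚ ℚ.+ (+ h / suc m)))
      (ℚᵘₚ.*-cong (toℚᵘ-/ (+ a) m) (ℚᵘₚ.≃-trans (ℚₚ.toℚᵘ-homo-+ 1ℚ (+ h / suc m)) (ℚᵘₚ.+-congʳ 1ℚᵘ (toℚᵘ-/ (+ h) m))))))

  -- This is a(L + h) - L² with one factor of L² written as A + a, so that the terms aL cancel.
  numerator : ∀ a A h m → A + a ≡ suc m → ℚᵘ.↥ (a[1+h]-1 a h m) ≡ (a * h) ⊖ (suc m * A)
  numerator a A h m A+a≡L = begin
    + a ℤ.* (+ 1 ℤ.* + L ℤ.+ + h ℤ.* + 1) ℤ.* + 1 ℤ.+ -[1+ 0 ] ℤ.* + (L * (1 * L))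
      ≡⟨ cong (λ d → + a ℤ.* (+ 1 ℤ.* + L ℤ.+ + h ℤ.* + 1) ℤ.* + 1 ℤ.+ -[1+ 0 ] ℤ.* d)
           (trans (cong (λ l → + (L * l)) (*-identityˡ L)) (ℤₚ.pos-* L L)) ⟩
    + a ℤ.* (+ 1 ℤ.* + L ℤ.+ + h ℤ.* + 1) ℤ.* + 1 ℤ.+ -[1+ 0 ] ℤ.* (+ L ℤ.* + L)
      ≡⟨ cong (λ l → + a ℤ.* (+ 1 ℤ.* + L ℤ.+ + h ℤ.* + 1) ℤ.* + 1 ℤ.+ -[1+ 0 ] ℤ.* (+ L ℤ.* l))
           (trans (cong +_ (sym A+a≡L)) (ℤₚ.pos-+ A a)) ⟩
    + a ℤ.* (+ 1 ℤ.* + L ℤ.+ + h ℤ.* + 1) ℤ.* + 1 ℤ.+ -[1+ 0 ] ℤ.* (+ L ℤ.* (+ A ℤ.+ + a))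
      ≡⟨ identity (+ a) (+ A) (+ h) (+ L) ⟩
    + a ℤ.* + h ℤ.- + L ℤ.* + A
      ≡⟨ cong₂ ℤ._-_ (sym (ℤₚ.pos-* a h)) (sym (ℤₚ.pos-* L A)) ⟩
    + (a * h) ℤ.- + (L * A)
      ≡⟨ ℤₚ.m-n≡m⊖n (a * h) (L * A) ⟩
    (a * h) ⊖ (L * A) ∎
    where
    open ≡-Reasoning
    L = suc m
    identity : ∀ a A h L → a ℤ.* (+ 1 ℤ.* L ℤ.+ h ℤ.* + 1) ℤ.* + 1 ℤ.+ -[1+ 0 ] ℤ.* (L ℤ.* (A ℤ.+ a)) ≡ a ℤ.* h ℤ.- L ℤ.* A
    identity = ℤ-Solver.solve-∀

-- With L = m + 1 = A + a, the difference is (a h − L A) / L².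
∣a[1+h]-1∣<ε : ∀ a A h m {ε} → A + a ≡ suc m → a * h ≤ suc m * A + 3 * suc m → suc m * A ≤ a * h + 3 * suc m →
  0ℚ ℚ.< ε → 3 * ℚ.denominatorℕ ε ≤ m → ℚ.∣ (+ a / suc m) ℚ.* (1ℚ ℚ.+ (+ h / suc m)) ℚ.- 1ℚ ∣ ℚ.< ε
∣a[1+h]-1∣<ε a A h m {mkℚ (+ zero) d _} _ _ _ (ℚ.*<* (+<+ ())) _
∣a[1+h]-1∣<ε a A h m {mkℚ -[1+ _ ] d _} _ _ _ (ℚ.*<* ()) _
∣a[1+h]-1∣<ε a A h m {mkℚ (+ suc e) d _} A+a≡L ah≤ LA≤ _ 3d≤m = ℚₚ.toℚᵘ-cancel-< (ℚᵘₚ.<-respˡ-≃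
  (ℚᵘₚ.≃-sym (ℚᵘₚ.≃-trans (ℚₚ.toℚᵘ-homo-∣-∣ ((+ a / suc m) ℚ.* (1ℚ ℚ.+ (+ h / suc m)) ℚ.- 1ℚ)) (ℚᵘₚ.∣-∣-cong (toℚᵘ-a[1+h]-1 a h m))))
  (*<* (subst₂ ℤ._<_ (ℤₚ.pos-* num (suc d)) (ℤₚ.pos-* (suc e) (L * (1 * L) * 1)) (+<+ (begin-strict
    num * suc d              ≤⟨ *-monoˡ-≤ (suc d) num≤3L ⟩
    3 * L * suc d            ≡⟨ rearrange L (suc d) ⟩
    3 * suc d * L            <⟨ *-monoˡ-< L (s≤s 3d≤m) ⟩
    L * L                    ≤⟨ m≤m+n (L * L) (e * (L * L)) ⟩
    suc e * (L * L)          ≡⟨ cong (suc e *_) (trans (cong (L *_) (sym (*-identityˡ L))) (sym (*-identityʳ _))) ⟩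
    suc e * (L * (1 * L) * 1) ∎)))))
  where
  open ≤-Reasoning
  L = suc m
  num = ℤ.∣ ℚᵘ.↥ (a[1+h]-1 a h m) ∣
  num≤3L : num ≤ 3 * L
  num≤3L = ≤-trans (≤-reflexive (cong ℤ.∣_∣ (numerator a A h m A+a≡L))) (∣⊖∣-≤-bound ah≤ LA≤)
  rearrange : ∀ L d → 3 * L * d ≡ 3 * d * L
  rearrange = ℕ-Solver.solve-∀

/-+-/≡1 : ∀ a b m → a + b ≡ suc m → (+ a / suc m) ℚ.+ (+ b / suc m) ≡ 1ℚ
/-+-/≡1 a b m a+b≡L = ℚₚ.toℚᵘ-injective (ℚᵘₚ.≃-trans (ℚₚ.toℚᵘ-homo-+ (+ a / suc m) (+ b / suc m))
  (ℚᵘₚ.≃-trans (ℚᵘₚ.+-cong (toℚᵘ-/ (+ a) m) (toℚᵘ-/ (+ b) m)) (ℚᵘ.*≡* (begin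
    (+ a ℤ.* + L ℤ.+ + b ℤ.* + L) ℤ.* + 1   ≡⟨ ℤₚ.*-identityʳ _ ⟩
    + a ℤ.* + L ℤ.+ + b ℤ.* + L             ≡⟨ sym (ℤₚ.*-distribʳ-+ (+ L) (+ a) (+ b)) ⟩
    (+ a ℤ.+ + b) ℤ.* + L                   ≡⟨ cong (λ l → l ℤ.* + L) (trans (sym (ℤₚ.pos-+ a b)) (cong +_ a+b≡L)) ⟩
    + L ℤ.* + L                             ≡⟨ sym (ℤₚ.pos-* L L) ⟩
    + (L * L)                               ≡⟨ sym (ℤₚ.*-identityˡ _) ⟩
    + 1 ℤ.* + (L * L)                       ∎))))
  where
  open ≡-Reasoning
  L = suc m

module _ (u b : ℕ → Fin 2) (balb : Balanced _≟_ 1 b) (e : Fin 2)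
         (a≤e : ∀ n → occ u zero 0 n ≤ suc (occ b e 0 (occ u 1F 0 n)))
         (e≤a : ∀ n → occ b e 0 (occ u 1F 0 n) ≤ suc (occ u zero 0 n)) where

  -- Let a prefix of length L hold A letters a and k letters b. Alternation puts A within one of the
  -- count of `e` in the first k letters of `b`, and `balanced-drift` compares that count with the
  -- one in the first L letters, where `ratio` measures it. Multiplied by L, the first error is at
  -- most L and the second at most 2L.
  alternate⇒LimEq : LimEq (λ m → αseq u m ℚ.* (1ℚ ℚ.+ ratio _≟_ b e m)) 1ℚ
  -- The total error is at most 3L / L² = 3 / L, while ε is at least the reciprocal of its
  -- denominator.
  alternate⇒LimEq ε 0<ε = 3 * ℚ.denominatorℕ ε , λ m N≤m →
    subst₂ (λ f g → ℚ.∣ (+ count _≟_ 1F f / suc m) ℚ.* (1ℚ ℚ.+ (+ count _≟_ e g / suc m)) ℚ.- 1ℚ ∣ ℚ.< ε)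
      (sym (fac≡window u 0 (suc m))) (sym (fac≡window b 0 (suc m)))
      (∣a[1+h]-1∣<ε (occ u 1F 0 (suc m)) (occ u zero 0 (suc m)) (occ b e 0 (suc m)) m
        (occ-binary u 0 (suc m)) (upper (suc m)) (lower (suc m)) 0<ε N≤m)
    where
    open ≤-Reasoning
    upper : ∀ L → occ u 1F 0 L * occ b e 0 L ≤ L * occ u zero 0 L + 3 * L
    upper L = begin
      k * occ b e 0 L                    ≤⟨ balanced-drift b balb e L k ⟩
      L * occ b e 0 k + (L + k)          ≤⟨ +-mono-≤ (*-monoʳ-≤ L (e≤a L)) (+-monoʳ-≤ L (Binary.occ-≤ u 1F 0 L)) ⟩
      L * suc (occ u zero 0 L) + (L + L) ≡⟨ rearrange L (occ u zero 0 L) ⟩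
      L * occ u zero 0 L + 3 * L         ∎
      where
      k = occ u 1F 0 L
      rearrange : ∀ L x → L * suc x + (L + L) ≡ L * x + 3 * L
      rearrange = ℕ-Solver.solve-∀
    lower : ∀ L → L * occ u zero 0 L ≤ occ u 1F 0 L * occ b e 0 L + 3 * L
    lower L = begin
      L * occ u zero 0 L                   ≤⟨ *-monoʳ-≤ L (a≤e L) ⟩
      L * suc (occ b e 0 k)                ≡⟨ *-suc L (occ b e 0 k) ⟩
      L + L * occ b e 0 k                  ≤⟨ +-monoʳ-≤ L (balanced-drift b balb e k L) ⟩
      L + (k * occ b e 0 L + (k + L))      ≤⟨ +-monoʳ-≤ L (+-monoʳ-≤ (k * occ b e 0 L) (+-monoˡ-≤ L (Binary.occ-≤ u 1F 0 L))) ⟩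
      L + (k * occ b e 0 L + (L + L))      ≡⟨ rearrange L (k * occ b e 0 L) ⟩
      k * occ b e 0 L + 3 * L              ∎
      where
      k = occ u 1F 0 L
      rearrange : ∀ L x → L + (x + (L + L)) ≡ x + 3 * L
      rearrange = ℕ-Solver.solve-∀

-- The ratios of 2 and 3 sum to 1 in every prefix, so the second excluded equation is the first with
-- the letter 2 in place of 3.
2-γ≡1+γ′ : ∀ b m → ℕtoℚ 2 ℚ.- γseq b m ≡ 1ℚ ℚ.+ ratio _≟_ b zero m
2-γ≡1+γ′ b m = trans (cong (λ one → 1ℚ ℚ.+ one ℚ.- γseq b m) (sym (/-+-/≡1 #2 #3 m counts)))
  (cancel 1ℚ (ratio _≟_ b zero m) (γseq b m))
  where
  #2 = count _≟_ zero (fac b 0 (suc m))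
  #3 = count _≟_ 1F (fac b 0 (suc m))
  counts : #2 + #3 ≡ suc m
  counts = subst (λ f → count _≟_ zero f + count _≟_ 1F f ≡ suc m) (sym (fac≡window b 0 (suc m))) (occ-binary b 0 (suc m))
  cancel : ∀ x y z → x ℚ.+ (y ℚ.+ z) ℚ.- z ≡ x ℚ.+ y
  cancel = solve 3 (λ x y z → x :+ (y :+ z) :- z := x :+ y) refl
    where open +-*-Solver

-- The colouring is not 1-balanced

binary-≢-≢⇒≡ : ∀ (x y z : Fin 2) → y ≢ x → z ≢ x → y ≡ z
binary-≢-≢⇒≡ = from-yes (all? {n = 2} λ x → all? λ y → all? λ z → ¬? (y ≟ x) →-dec ¬? (z ≟ x) →-dec (y ≟ z))

aperiodic⇒recurrent : ∀ w → ¬ EventuallyPeriodic w → ∀ (x : Fin 2) N → ¬ ¬ ∃ λ i → w (N + i) ≡ x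
aperiodic⇒recurrent w aper x N ¬x = aper (1 , ≤-refl , N , λ i N≤i →
  binary-≢-≢⇒≡ x (w (i + 1)) (w i) (avoid (≤-trans N≤i (m≤m+n i 1))) (avoid N≤i))
  where
  avoid : ∀ {i} → N ≤ i → w i ≢ x
  avoid N≤i wi≡x = ¬x (_ , trans (cong w (m+[n∸m]≡n N≤i)) wi≡x)

-- The count grows by at most one per letter. If it never reached `suc m`, it would stay at `m` from
-- `n` on, although `c` occurs again.
window-with-count : ∀ w → ¬ EventuallyPeriodic w → ∀ c i m → ¬ ¬ ∃ λ n → occ w c i n ≡ m
window-with-count w aper c i zero    ¬n = ¬n (0 , refl)
window-with-count w aper c i (suc m) ¬n = window-with-count w aper c i m λ (n , eq) →
  aperiodic⇒recurrent w aper c (i + n) λ (k , e) →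
    reached (n + k) (stuck n eq k) (trans (cong w (sym (+-assoc i n k))) e)
  where
  reached : ∀ n → occ w c i n ≡ m → w (i + n) ≢ c
  reached n eq e = ¬n (suc n , trans (Binary.occ-snoc w c i n) (trans (cong₂ _+_ eq (Binary.count-yes e)) (+-comm m 1)))
  stuck : ∀ n → occ w c i n ≡ m → ∀ k → occ w c i (n + k) ≡ m
  stuck n eq zero    = trans (cong (occ w c i) (+-identityʳ n)) eq
  stuck n eq (suc k) = trans (cong (occ w c i) (+-suc n k)) (trans (Binary.occ-snoc w c i (n + k))
    (trans (cong₂ _+_ (stuck n eq k) (Binary.count-no (reached (n + k) (stuck n eq k)))) (+-identityʳ m)))

encode : V → Fin 3
encode (inj₁ zero) = zero
encode (inj₂ zero) = 1F
encode (inj₂ 1F)   = 2F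

encode-injective : ∀ {x y} → encode x ≡ encode y → x ≡ y
encode-injective {inj₁ zero} {inj₁ zero} _ = refl
encode-injective {inj₁ zero} {inj₂ zero} ()
encode-injective {inj₁ zero} {inj₂ 1F}   ()
encode-injective {inj₂ zero} {inj₁ zero} ()
encode-injective {inj₂ zero} {inj₂ zero} _ = refl
encode-injective {inj₂ zero} {inj₂ 1F}   ()
encode-injective {inj₂ 1F}   {inj₁ zero} ()
encode-injective {inj₂ 1F}   {inj₂ zero} ()
encode-injective {inj₂ 1F}   {inj₂ 1F}   _ = refl

encode-surjective : ∀ c → ∃ λ x → encode x ≡ c
encode-surjective zero = inj₁ zero , refl
encode-surjective 1F   = inj₂ zero , refl
encode-surjective 2F   = inj₂ 1F   , refl

module _ (u b : ℕ → Fin 2) (stu : Sturmian u) (stb : Sturmian b) where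
  open Coloured u b

  private
    apeu = proj₂ stu
    balb = proj₁ stb
    apeb = proj₂ stb

  -- The way back from `b` to `v`: any window of `b` starting at or after `B N` is the b-part of a
  -- window of `v` starting at or after `N`.
  b-window : ∀ N i n → ¬ ¬ ∃ λ s → ∃ λ t → B (N + s) ≡ B N + i × occ u 1F (N + s) t ≡ n
  b-window N i n ¬st = window-with-count u apeu 1F N i λ (s , eq) →
    window-with-count u apeu 1F (N + s) n λ (t , eq′) →
    ¬st (s , t , trans (B-+ N s) (cong (λ k → B N + k) eq) , eq′)

  coloured-aperiodic : ¬ EventuallyPeriodic v
  coloured-aperiodic (p , 1≤p , N , per) = apeu (p , 1≤p , N , λ i N≤i →
    trans (sym (uncolour-v u b (i + p))) (trans (cong uncolour (per i N≤i)) (uncolour-v u b i)))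

  coloured-recurrent : ∀ x N → ¬ ¬ ∃ λ i → v (N + i) ≡ x
  coloured-recurrent (inj₁ zero) N ¬i = aperiodic⇒recurrent u apeu zero N λ (i , eq) → ¬i (i , v-at-a eq)
  coloured-recurrent (inj₂ c)    N ¬i = aperiodic⇒recurrent b apeb c (B N) λ (i , bi≡c) →
    b-window N i 1 λ (s , t , Bs , one) →
    let (k , eq) = Letters.occ-positive v (inj₂ c) (N + s) t (≤-reflexive (sym (begin
          Letters.occ v (inj₂ c) (N + s) t         ≡⟨ occ-inj₂ c (N + s) t ⟩
          occ b c (B (N + s)) (occ u 1F (N + s) t) ≡⟨ cong₂ (occ b c) Bs one ⟩
          occ b c (B N + i) 1                      ≡⟨ Binary.count-yes bi≡c ⟩
          1                                        ∎)))
    in ¬i (s + k , trans (cong v (sym (+-assoc N s k))) eq)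
    where open ≡-Reasoning

  private
    w : ℕ → Fin 3
    w = encode ∘ v

  occ-encode : ∀ x i n → Ternary.occ w (encode x) i n ≡ Letters.occ v x i n
  occ-encode = occ-map _≟V_ _≟_ encode encode-injective v

  encoded-balancedAperiodic : Balanced _≟V_ 1 v → BalancedAperiodic w
  encoded-balancedAperiodic bal = record
    { balanced  = Ternary.≤⇒balanced λ c i j n → case encode-surjective c of λ where
        (x , refl) → subst₂ (λ p q → p ≤ suc q) (sym (occ-encode x i n)) (sym (occ-encode x j n)) (Letters.balanced⇒≤ v bal x i j n)
    ; recurrent = λ c N ¬i → case encode-surjective c of λ where
        (x , refl) → coloured-recurrent x N λ (i , eq) → ¬i (i , cong encode eq)
    ; aperiodic = λ (p , 1≤p , N , per) → coloured-aperiodic (p , 1≤p , N , λ i N≤i → encode-injective (per i N≤i))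
    }

  dominates-encode : ∀ x y → Dominates w (encode x) (encode y) → ∀ i n → Letters.occ v y i n ≤ suc (Letters.occ v x i n)
  dominates-encode x y dom i n = subst₂ (λ p q → p ≤ suc q) (occ-encode y i n) (occ-encode x i n) (dom i n)

  -- A square in `b` is the b-part of a window of `v` with two of one coloured letter and none of
  -- the other, which alternation forbids. A binary sequence without squares has period 2.
  ¬alternate-23 : ¬ Alternate w 1F 2F
  ¬alternate-23 (3≤2 , 2≤3) = apeb (2 , s≤s z≤n , 0 , λ m _ → trans (cong b (+-comm m 2))
      (binary-≢-≢⇒≡ (b (suc m)) (b (2 + m)) (b m) (≢-sym (b-square-free (suc m))) (b-square-free m)))
    where
    occ-b-≤ : ∀ c c′ → (∀ i n → Letters.occ v (inj₂ c) i n ≤ suc (Letters.occ v (inj₂ c′) i n)) →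
      ∀ m → ¬ ¬ (occ b c m 2 ≤ suc (occ b c′ m 2))
    occ-b-≤ c c′ dom m ¬le = b-window 0 m 2 λ (s , t , Bs , two) →
      ¬le (subst₂ (λ p q → p ≤ suc q)
        (trans (occ-inj₂ c s t) (cong₂ (occ b c) Bs two)) (trans (occ-inj₂ c′ s t) (cong₂ (occ b c′) Bs two)) (dom s t))

    square-dominates : ∀ {m c c′} → c ≢ c′ → b m ≡ c → b (suc m) ≡ c → ¬ (occ b c m 2 ≤ suc (occ b c′ m 2))
    square-dominates {m} {c} {c′} c≢c′ e₀ e₁ le = 1+n≰n (subst₂ (λ p q → p ≤ suc q)
      (trans (Binary.count-yes e₀) (cong suc (Binary.count-yes e₁)))
      (trans (Binary.count-no (c≢c′ ∘ trans (sym e₀))) (Binary.count-no (c≢c′ ∘ trans (sym e₁)))) le)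

    b-square-free : ∀ m → b m ≢ b (suc m)
    b-square-free m eq with zero-or-one (b m)
    ... | inj₁ e = occ-b-≤ zero 1F (dominates-encode (inj₂ 1F) (inj₂ zero) 2≤3) m (square-dominates (λ ()) e (trans (sym eq) e))
    ... | inj₂ e = occ-b-≤ 1F zero (dominates-encode (inj₂ zero) (inj₂ 1F) 3≤2) m (square-dominates (λ ()) e (trans (sym eq) e))

  alternate-1c⇒LimEq : ∀ c → Alternate w zero (encode (inj₂ c)) → LimEq (λ m → αseq u m ℚ.* (ℚ.1ℚ ℚ.+ ratio _≟_ b c m)) ℚ.1ℚ
  alternate-1c⇒LimEq c (c≤1 , 1≤c) = alternate⇒LimEq u b balb c
    (λ n → subst₂ (λ p q → p ≤ suc q) (occ-inj₁ 0 n) (occ-inj₂ c 0 n) (dominates-encode (inj₂ c) (inj₁ zero) 1≤c 0 n))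
    (λ n → subst₂ (λ p q → p ≤ suc q) (occ-inj₂ c 0 n) (occ-inj₁ 0 n) (dominates-encode (inj₁ zero) (inj₂ c) c≤1 0 n))

  ¬1-balanced : ¬ AlphaEq1/1+γ u b → ¬ AlphaEq1/2-γ u b → ¬ Balanced _≟V_ 1 v
  ¬1-balanced ¬1+γ ¬2-γ bal = alternating-pair w (encoded-balancedAperiodic bal) λ where
      (zero , zero , p≢q , _)   → p≢q refl
      (zero , 1F   , _   , alt) → alternate-12 alt
      (zero , 2F   , _   , alt) → ¬1+γ (alternate-1c⇒LimEq 1F alt)
      (1F   , zero , _   , alt) → alternate-12 (swap alt)
      (1F   , 1F   , p≢q , _)   → p≢q refl
      (1F   , 2F   , _   , alt) → ¬alternate-23 alt
      (2F   , zero , _   , alt) → ¬1+γ (alternate-1c⇒LimEq 1F (swap alt))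
      (2F   , 1F   , _   , alt) → ¬alternate-23 (swap alt)
      (2F   , 2F   , p≢q , _)   → p≢q refl
    where
    alternate-12 : ¬ Alternate w zero 1F
    alternate-12 alt = ¬2-γ λ ε 0<ε → let (N , h) = alternate-1c⇒LimEq zero alt ε 0<ε in
      N , λ m N≤m → subst (λ x → ℚ.∣ αseq u m ℚ.* x ℚ.- ℚ.1ℚ ∣ ℚ.< ε) (sym (2-γ≡1+γ′ b m)) (h m N≤m)

theorem4 : (u b : ℕ → Fin 2) → Sturmian u → Sturmian b →
    Balanced _≟V_ 2 (colour u one-ω b)
    × ((¬ AlphaEq1/1+γ u b × ¬ AlphaEq1/2-γ u b) → ¬ Balanced _≟V_ 1 (colour u one-ω b))
    × (∀ (n : ℕ) → 1 ≤ n → ∀ (ka kb p c : ℕ) →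
    IsFloor1-αn u n ka → IsCeilNα u n kb →
    HasCard (IsPFactor u n ka kb) p →
    HasCard (IsFactor (colour u one-ω b) n) c →
    c ≤ p + suc n * kb)
    × (∀ (n : ℕ) → 1 ≤ n → ∀ (c : ℕ) →
    HasCard (IsParikhFactorV (colour u one-ω b) n) c → c ≤ 4)
theorem4 u b stu@(balu , _) stb@(balb , _) =
    colour-2-balanced balu balb
  , (λ (¬1+γ , ¬2-γ) → ¬1-balanced u b stu stb ¬1+γ ¬2-γ)
  , complexity-≤ u b balu balb
  , (λ n _ → abelian-complexity-≤-4 balu balb n)
  where open Coloured u b
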